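{- Let $\ell>0$ and $b\neq0$ be integers with $\ell^2+4b\geq0$, and let $\mathbf{s}$ be defined by $s_0=0$, $s_1=1$, $s_n=\ell s_{n-1}+bs_{n-2}$ for $n\geq2$. Then the $h^*$-vector of $\mathcal{R}_n^{(\mathbf{s})}$ is symmetric for all $n\geq0$ if and only if $b=-1$. If $b\neq-1$, there is an integer $n_0=n_0(b,\ell)$ such that for all $n\geq n_0$ the $h^*$-vector of $\mathcal{R}_n^{(\mathbf{s})}$ is not symmetric.
   Context: Let $\mathcal{C}_n^{(\mathbf{s})}=\{\lambda\in\mathbb{R}^n: 0\leq\lambda_1/s_1\leq\cdots\leq\lambda_n/s_n\}$, $\mathcal{L}_n^{(\mathbf{s})}=\mathcal{C}_n^{(\mathbf{s})}\cap\mathbb{Z}^n$, and $\mathcal{R}_n^{(\mathbf{s})}=\{\lambda\in\mathcal{C}_n^{(\mathbf{s})}:\lambda_n\leq1\}$. For integers $t\geq0$ let $i(\mathcal{R}_n^{(\mathbf{s})},t)=|\{\lambda\in\mathcal{L}_n^{(\mathbf{s})}:\lambda_n\leq t\}|$ and $\mathcal{E}_n^{(\mathbf{s})}(x)=\sum_{t\geq0}i(\mathcal{R}_n^{(\mathbf{s})},t)x^t$. It is known that $Q_n^{(\mathbf{s})}(x):=(1-x^{s_n})^{n+1}\mathcal{E}_n^{(\mathbf{s})}(x)$ is a polynomial; its coefficient sequence is the $h^*$-vector of $\mathcal{R}_n^{(\mathbf{s})}$, which is called symmetric if it reads the same from left to right as from right to left. -}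

module Defs where

open import Data.Nat as ℕ using (ℕ; zero; suc; _∸_)
open import Data.Integer as ℤ using (ℤ; +_; _+_; _*_; _-_)
open import Data.Vec using (Vec; []; _∷_)
open import Data.List using (List; length)
open import Data.List.Relation.Unary.Unique.Propositional using (Unique)
open import Data.List.Membership.Propositional using (_∈_)
open import Data.Product using (Σ; _×_)
open import Data.Unit using (⊤)
open import Data.Bool using (if_then_else_)
open import Relation.Nullary.Decidable using (⌊_⌋)
open import Relation.Binary.PropositionalEquality using (_≡_; _≢_)

seq : ℤ → ℤ → ℕ → ℤ
seq ℓ b zero = + 0
seq ℓ b (suc zero) = + 1
seq ℓ b (suc (suc n)) = ℓ * seq ℓ b (suc n) + b * seq ℓ b n

-- ChainFrom s i a (c₁ ∷ c₂ ∷ …) : a/s_i ≤ c₁/s_{i+1} ≤ c₂/s_{i+2} ≤ …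
-- (each inequality x/s_j ≤ y/s_{j+1} written as x·s_{j+1} ≤ y·s_j,
--  which is the same inequality since the s_j (j ≥ 1) are positive)
ChainFrom : (ℕ → ℤ) → ℕ → ℤ → {m : ℕ} → Vec ℤ m → Set
ChainFrom s i a [] = ⊤
ChainFrom s i a (c ∷ cs) = (a * s (suc i) ℤ.≤ c * s i) × ChainFrom s (suc i) c cs

-- λ = (λ_1,…,λ_n) ∈ C_n^(s) ∩ ℤ^n : 0 ≤ λ_1/s_1 ≤ … ≤ λ_n/s_n  (s_1 = 1)
InCone : (ℕ → ℤ) → {n : ℕ} → Vec ℤ n → Set
InCone s [] = ⊤
InCone s (a ∷ as) = (+ 0 ℤ.≤ a) × ChainFrom s 1 a as

LastLe : {n : ℕ} → Vec ℤ n → ℤ → Set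
LastLe [] t = ⊤
LastLe (a ∷ []) t = a ℤ.≤ t
LastLe (a ∷ b ∷ as) t = LastLe (b ∷ as) t

IsCount : {A : Set} → (A → Set) → ℕ → Set
IsCount {A} P c =
  Σ (List A) λ xs → Unique xs × ((x : A) → (x ∈ xs → P x) × (P x → x ∈ xs)) × (length xs ≡ c)

-- i(t) = i(R_n^(s), t) = |{λ ∈ L_n^(s) : λ_n ≤ t}| for all t
IsEhrhartFn : (ℕ → ℤ) → (n : ℕ) → (ℕ → ℕ) → Set
IsEhrhartFn s n i = (t : ℕ) → IsCount (λ (v : Vec ℤ n) → InCone s v × LastLe v (+ t)) (i t)

FPS : Set
FPS = ℕ → ℤ

sumTo : ℕ → (ℕ → ℤ) → ℤ
sumTo zero f = f 0
sumTo (suc k) f = sumTo k f + f (suc k)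

_⊛_ : FPS → FPS → FPS
(f ⊛ g) k = sumTo k (λ j → f j * g (k ∸ j))

oneS : FPS
oneS k = if ⌊ k ℕ.≟ 0 ⌋ then + 1 else + 0

oneMinusXPow : ℤ → FPS
oneMinusXPow S k = oneS k - (if ⌊ + k ℤ.≟ S ⌋ then + 1 else + 0)

_^ₛ_ : FPS → ℕ → FPS
f ^ₛ zero = oneS
f ^ₛ suc n = f ⊛ (f ^ₛ n)

ehrhartSeries : (ℕ → ℕ) → FPS
ehrhartSeries i t = + (i t)

QPoly : (ℕ → ℤ) → ℕ → (ℕ → ℕ) → FPS
QPoly s n i = (oneMinusXPow (s n) ^ₛ suc n) ⊛ ehrhartSeries i

SymmetricPoly : FPS → Set
SymmetricPoly c =
  Σ ℕ λ d → (c d ≢ + 0) × ((k : ℕ) → d ℕ.< k → c k ≡ + 0)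
          × ((k : ℕ) → k ℕ.≤ d → c k ≡ c (d ∸ k))

HStarSymmetric : (ℕ → ℤ) → ℕ → Set
HStarSymmetric s n = (i : ℕ → ℕ) → IsEhrhartFn s n i → SymmetricPoly (QPoly s n i)

-- Sorting the lattice points by their last coordinate computes the Ehrhart function of R_n and that of
-- its interior by the same recursion through floors, the second one with x ↦ ⌊(x a − 1)/m⌋ instead of
-- x ↦ ⌊x a/m⌋.  This recursion is compatible with the differences Δ_S g(t) = g(t) − g(t − S), the h*-vector
-- is Δ_{s_n}^{n+1} of the Ehrhart function, and reciprocity follows by telescoping.  Hence h* is symmetric
-- iff the interior count is the translate of the closed count by some c_n.  Comparing the places where both
-- sides jump shows that this property passes from n to n − 1, and that c_n s_{n−1} − c_{n−1} s_n is
-- w_n = gcd(s_{n−1}, s_n).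
--
-- For b = −1 Cassini's identity makes c_n = s_n + s_{n−1} work for every n.  In general the recurrence
-- yields s_n ∣ b w_n + w_{n+1}.  Since w_n² divides s_n² − s_{n−1} s_{n+1} = (−b)^{n−1} while
-- s_n² / |b|^{n−1} is unbounded, b w_n + w_{n+1} = 0 for suitable n.  This is absurd for b > 0; for b < 0, two
-- consecutive occurrences make ℓ a unit modulo b while b ∣ s_n, which forces b ∣ s_1 = 1.

module Submission where

open import Defs
open import Data.Nat as ℕ using (ℕ; zero; suc; _∸_)
open import Data.Integer as ℤ
  using (ℤ; +_; -[1+_]; _+_; _*_; _-_; -_; _≤_; _<_; _/ℕ_; +≤+; -≤+; ∣_∣)
open import Data.Product using (Σ; _×_; _,_; proj₁; proj₂)
open import Function.Bundles using (_⇔_; mk⇔; Equivalence)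
open import Relation.Nullary using (¬_; yes; no)
open import Relation.Binary.PropositionalEquality
  using (_≡_; _≢_; refl; sym; trans; cong; cong₂; subst; subst₂)
import Algebra.Properties.AbelianGroup as AbelianGroup
open import Data.Empty using (⊥-elim)
open import Data.Integer.DivMod using ([n/ℕd]*d≤n; n<s[n/ℕd]*d)
open import Data.Integer.Divisibility.Signed as ℤ∣ using (_∣_; divides)
open import Data.Integer.Properties
open import Data.Integer.Tactic.RingSolver using (solve-∀)
open import Data.List as List using (List; []; _∷_; _++_; length)
open import Data.List.Membership.Propositional using (_∈_)
open import Data.List.Membership.Propositional.Properties
  using (∈-map⁺; ∈-map⁻; ∈-++⁺ˡ; ∈-++⁺ʳ; ∈-++⁻)
open import Data.List.Membership.Propositional.Properties.WithK using (unique∧set⇒bag)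
open import Data.List.Properties using (length-++; length-map)
open import Data.List.Relation.Binary.BagAndSetEquality using (∼bag⇒↭)
open import Data.List.Relation.Binary.Permutation.Propositional.Properties using (↭-length)
open import Data.List.Relation.Unary.All using () renaming ([] to []ᴬ)
open import Data.List.Relation.Unary.AllPairs using () renaming ([] to []ᴾ; _∷_ to _∷ᴾ_)
open import Data.List.Relation.Unary.Any using (here)
open import Data.List.Relation.Unary.Unique.Propositional using (Unique)
import Data.List.Relation.Unary.Unique.Propositional.Properties as Unique
import Data.Nat.Divisibility as ℕ∣
import Data.Nat.Properties as ℕₚ
import Data.Nat.Tactic.RingSolver as ℕ-Ring
open import Data.Sum using (_⊎_; inj₁; inj₂)
open import Data.Unit using (tt)
open import Data.Vec using (Vec; []; _∷_; _∷ʳ_; initLast)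
open import Data.Vec.Properties using (∷ʳ-injective; ∷ʳ-injectiveˡ)
open import Function using (_∘_)

-- Inequalities and floors

≤-offset : ∀ {x y} d → + 0 ≤ d → y ≡ x + d → x ≤ y
≤-offset {x} d 0≤d refl = subst (_≤ x + d) (+-identityʳ x) (+-monoʳ-≤ x 0≤d)

0≤-+ : ∀ {x y} → + 0 ≤ x → + 0 ≤ y → + 0 ≤ x + y
0≤-+ = +-mono-≤

0≤-* : ∀ {x y} → + 0 ≤ x → + 0 ≤ y → + 0 ≤ x * y
0≤-* {+ m} {+ n} _ _ = subst (+ 0 ≤_) (pos-* m n) (+≤+ ℕ.z≤n)

1+≤⇒< : ∀ {x y} → + 1 + x ≤ y → x < y
1+≤⇒< = suc[i]≤j⇒i<j

<⇒1+≤ : ∀ {x y} → x < y → + 1 + x ≤ y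
<⇒1+≤ = i<j⇒suc[i]≤j

0≤gap : ∀ {x y} → x < y → + 0 ≤ y - x - + 1
0≤gap {x} {y} x<y = subst (+ 0 ≤_) (eq x y) (i≤j⇒0≤j-i (<⇒1+≤ x<y))
  where eq : ∀ x y → y - (+ 1 + x) ≡ y - x - + 1
        eq = solve-∀

<-offset : ∀ {x y} d → + 0 ≤ d → y ≡ x + d + + 1 → x < y
<-offset {x} {y} d 0≤d e = 1+≤⇒< (≤-offset d 0≤d (trans e (eq x d)))
  where eq : ∀ x d → x + d + + 1 ≡ + 1 + x + d
        eq = solve-∀

dichotomy : ∀ x y → (x ≤ y) ⊎ (y < x)
dichotomy x y with x ≤? y
... | yes p = inj₁ p
... | no p = inj₂ (≰⇒> p)

≤floor⇒*≤ : ∀ {q x} d .{{_ : ℕ.NonZero d}} → q ≤ x /ℕ d → q * + d ≤ x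
≤floor⇒*≤ {q} {x} d q≤ = ≤-trans (*-monoʳ-≤-nonNeg (+ d) q≤) ([n/ℕd]*d≤n x d)

<1+⇒≤ : ∀ {x y} → x < + 1 + y → x ≤ y
<1+⇒≤ {x} {y} x< = subst (x ≤_) (pred-suc y) (i<j⇒i≤pred[j] x<)

*-cancel-<1+ : ∀ {x y} d .{{_ : ℕ.NonZero d}} → x * + d < (+ 1 + y) * + d → x ≤ y
*-cancel-<1+ {x} {y} d lt = <1+⇒≤ (*-cancelʳ-<-nonNeg {x} {+ 1 + y} (+ d) lt)

*≤⇒≤floor : ∀ {q x} d .{{_ : ℕ.NonZero d}} → q * + d ≤ x → q ≤ x /ℕ d
*≤⇒≤floor {q} {x} d qd≤ = *-cancel-<1+ {q} {x /ℕ d} d (≤-<-trans qd≤ (n<s[n/ℕd]*d x d))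

floor-unique : ∀ {q x} d .{{_ : ℕ.NonZero d}} → q * + d ≤ x → x < (+ 1 + q) * + d → x /ℕ d ≡ q
floor-unique {q} {x} d lo hi = ≤-antisym
  (*-cancel-<1+ {x /ℕ d} {q} d (≤-<-trans ([n/ℕd]*d≤n x d) hi))
  (*≤⇒≤floor d lo)

floor-mono : ∀ {x y} d .{{_ : ℕ.NonZero d}} → x ≤ y → x /ℕ d ≤ y /ℕ d
floor-mono d x≤y = *≤⇒≤floor d (≤-trans ([n/ℕd]*d≤n _ d) x≤y)

floor-+ : ∀ x k d .{{_ : ℕ.NonZero d}} → (x + k * + d) /ℕ d ≡ x /ℕ d + k
floor-+ x k d = floor-unique d
  (subst (_≤ x + k * + d) (sym (*-distribʳ-+ (+ d) (x /ℕ d) k)) (+-monoˡ-≤ (k * + d) ([n/ℕd]*d≤n x d)))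
  (subst (x + k * + d <_) (eq (x /ℕ d) k (+ d)) (+-monoˡ-< (k * + d) (n<s[n/ℕd]*d x d)))
  where eq : ∀ q k d → (+ 1 + q) * d + k * d ≡ (+ 1 + (q + k)) * d
        eq = solve-∀

-- For integers the ceiling of (x + 1)/d is 1 + ⌊x/d⌋. In `reciprocity` this exchanges the floors
-- with offset 0 for those with offset 1.
floor-neg : ∀ x d .{{_ : ℕ.NonZero d}} → (- x - + 1) /ℕ d ≡ - + 1 - x /ℕ d
floor-neg x d = floor-unique d
  (≤-offset _ (0≤gap (n<s[n/ℕd]*d x d)) (eq₁ (x /ℕ d) x (+ d)))
  (<-offset _ (i≤j⇒0≤j-i ([n/ℕd]*d≤n x d)) (eq₂ (x /ℕ d) x (+ d)))
  where eq₁ : ∀ q x d → - x - + 1 ≡ (- + 1 - q) * d + ((+ 1 + q) * d - x - + 1)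
        eq₁ = solve-∀
        eq₂ : ∀ q x d → (+ 1 + (- + 1 - q)) * d ≡ - x - + 1 + (x - q * d) + + 1
        eq₂ = solve-∀

-- Difference operators on functions ℤ → ℤ

Δ : ℤ → (ℤ → ℤ) → ℤ → ℤ
Δ S g t = g t - g (t - S)

Δ^ : ℕ → ℤ → (ℤ → ℤ) → ℤ → ℤ
Δ^ zero    S g = g
Δ^ (suc k) S g = Δ S (Δ^ k S g)

Δ^-cong : ∀ k S {g h} → (∀ t → g t ≡ h t) → ∀ t → Δ^ k S g t ≡ Δ^ k S h t
Δ^-cong zero    S e t = e t
Δ^-cong (suc k) S e t = cong₂ _-_ (Δ^-cong k S e t) (Δ^-cong k S e (t - S))

Δ-Δ^-comm : ∀ k r S g t → Δ r (Δ^ k S g) t ≡ Δ^ k S (Δ r g) t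
Δ-Δ^-comm zero    r S g t = refl
Δ-Δ^-comm (suc k) r S g t = trans
  (trans (cong (λ z → G t - G (t - S) - (G (t - r) - G z)) (eq₀ t r S))
         (eq (G t) (G (t - S)) (G (t - r)) (G (t - S - r))))
  (cong₂ _-_ (Δ-Δ^-comm k r S g t) (Δ-Δ^-comm k r S g (t - S)))
  where
    G = Δ^ k S g
    eq₀ : ∀ t r S → t - r - S ≡ t - S - r
    eq₀ = solve-∀
    eq : ∀ x y z w → x - y - (z - w) ≡ x - z - (y - w)
    eq = solve-∀

Δ^-shift : ∀ k S g c t → Δ^ k S (λ u → g (u - c)) t ≡ Δ^ k S g (t - c)
Δ^-shift zero    S g c t = refl
Δ^-shift (suc k) S g c t = cong₂ _-_ (Δ^-shift k S g c t)
  (trans (Δ^-shift k S g c (t - S)) (cong (Δ^ k S g) (eq t S c)))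
  where eq : ∀ t S c → t - S - c ≡ t - c - S
        eq = solve-∀

-- Moving u by m moves u a - e by a m, hence its floor by exactly a. So differences of step m
-- outside the floor become differences of step a inside it.
Δ^-floor : ∀ k a e m .{{_ : ℕ.NonZero m}} g t →
  Δ^ k (+ m) (λ u → g ((u * a - e) /ℕ m)) t ≡ Δ^ k a g ((t * a - e) /ℕ m)
Δ^-floor zero    a e m g t = refl
Δ^-floor (suc k) a e m g t = cong₂ _-_ (Δ^-floor k a e m g t)
  (trans (Δ^-floor k a e m g (t - + m))
    (cong (Δ^ k a g) (trans (cong (_/ℕ m) (eq t (+ m) a e)) (floor-+ (t * a - e) (- a) m))))
  where eq : ∀ t m a e → (t - m) * a - e ≡ t * a - e + - a * m
        eq = solve-∀

ZeroBelow : ℤ → (ℤ → ℤ) → Set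
ZeroBelow t₀ g = ∀ t → t < t₀ → g t ≡ + 0

Δ^-zeroBelow : ∀ k S {t₀ g} → + 0 ≤ S → ZeroBelow t₀ g → ZeroBelow t₀ (Δ^ k S g)
Δ^-zeroBelow zero    S 0≤S z t t< = z t t<
Δ^-zeroBelow (suc k) S 0≤S z t t< = cong₂ _-_ (Δ^-zeroBelow k S 0≤S z t t<)
  (Δ^-zeroBelow k S 0≤S z (t - S) (≤-<-trans (≤-offset S 0≤S (eq t S)) t<))
  where eq : ∀ t S → t ≡ t - S + S
        eq = solve-∀

self≤abs : ∀ x → x ≤ + ∣ x ∣
self≤abs (+ n)    = ≤-refl
self≤abs -[1+ n ] = -≤+

-- Walking left in steps of S ≥ 1, at most `suc ∣ t - t₀ ∣` of them reach the region where g is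
-- known to vanish.
periodic-zero : ∀ S {t₀ g} → + 1 ≤ S → ZeroBelow t₀ g → (∀ t → g t ≡ g (t - S)) → ∀ t → g t ≡ + 0
periodic-zero S {t₀} {g} 1≤S z per t = below (suc ∣ t - t₀ ∣) t t<
  where
    below : ∀ k u → u < t₀ + + k → g u ≡ + 0
    below zero    u u< = z u (subst (u <_) (+-identityʳ t₀) u<)
    below (suc k) u u< = trans (per u) (below k (u - S)
      (<-offset (t₀ + + suc k - u - + 1 + (S - + 1)) (0≤-+ (0≤gap u<) (i≤j⇒0≤j-i 1≤S))
        (eq t₀ (+ k) u S)))
      where eq : ∀ t k u S → t + k ≡ u - S + (t + (+ 1 + k) - u - + 1 + (S - + 1)) + + 1
            eq = solve-∀
    t< : t < t₀ + + suc ∣ t - t₀ ∣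
    t< = <-offset (+ ∣ t - t₀ ∣ - (t - t₀)) (i≤j⇒0≤j-i (self≤abs (t - t₀))) (eq t₀ t (+ ∣ t - t₀ ∣))
      where eq : ∀ t₀ t a → t₀ + (+ 1 + a) ≡ t + (a - (t - t₀)) + + 1
            eq = solve-∀

-- Equal differences make g - h periodic with period S, and it vanishes far to the left.
Δ-injective : ∀ S {t₀ g h} → + 1 ≤ S → ZeroBelow t₀ g → ZeroBelow t₀ h →
  (∀ t → Δ S g t ≡ Δ S h t) → ∀ t → g t ≡ h t
Δ-injective S {t₀} {g} {h} 1≤S zg zh e t = i-j≡0⇒i≡j (g t) (h t)
  (periodic-zero S {g = λ u → g u - h u} 1≤S (λ u u< → cong₂ _-_ (zg u u<) (zh u u<)) per t)
  where
    per : ∀ u → g u - h u ≡ g (u - S) - h (u - S)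
    per u = trans (eq₁ (g u) (g (u - S)) (h u))
      (trans (cong (λ z → z + g (u - S) - h u) (e u)) (eq₂ (h u) (h (u - S)) (g (u - S))))
      where eq₁ : ∀ x y z → x - z ≡ x - y + y - z
            eq₁ = solve-∀
            eq₂ : ∀ x y z → x - y + z - x ≡ z - y
            eq₂ = solve-∀

Δ^-injective : ∀ k S {t₀ g h} → + 1 ≤ S → ZeroBelow t₀ g → ZeroBelow t₀ h →
  (∀ t → Δ^ k S g t ≡ Δ^ k S h t) → ∀ t → g t ≡ h t
Δ^-injective zero    S 1≤S zg zh e = e
Δ^-injective (suc k) S 1≤S zg zh e = Δ^-injective k S 1≤S zg zh
  (Δ-injective S 1≤S (Δ^-zeroBelow k S 0≤S zg) (Δ^-zeroBelow k S 0≤S zh) e)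
  where 0≤S = ≤-trans (+≤+ ℕ.z≤n) 1≤S

-- The inverse of `Δ (+ 1)` among functions that vanish on the negative integers.
Σ⁺ : (ℤ → ℤ) → ℤ → ℤ
Σ⁺ g (+ n)    = sumTo n (g ∘ +_)
Σ⁺ g -[1+ n ] = + 0

Σ⁺-zeroBelow : ∀ g → ZeroBelow (+ 0) (Σ⁺ g)
Σ⁺-zeroBelow g (+ n)    t<0 = ⊥-elim (+≮0 t<0)
Σ⁺-zeroBelow g -[1+ n ] _   = refl

Δ-Σ⁺ : ∀ {g} → ZeroBelow (+ 0) g → ∀ t → Δ (+ 1) (Σ⁺ g) t ≡ g t
Δ-Σ⁺ {g} z (+ zero)  = +-identityʳ (g (+ 0))
Δ-Σ⁺ {g} z (+ suc n) = eq (sumTo n (g ∘ +_)) (g (+ suc n))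
  where eq : ∀ x y → x + y - x ≡ y
        eq = solve-∀
Δ-Σ⁺ {g} z -[1+ n ]  = sym (z -[1+ n ] ℤ.-<+)

Σ⁺-step : ∀ {g} → ZeroBelow (+ 0) g → ∀ t → Σ⁺ g t ≡ Σ⁺ g (t - + 1) + g t
Σ⁺-step {g} z t = trans (eq (Σ⁺ g t) (Σ⁺ g (t - + 1))) (cong (λ w → Σ⁺ g (t - + 1) + w) (Δ-Σ⁺ z t))
  where eq : ∀ x y → x ≡ y + (x - y)
        eq = solve-∀

heaviside : ℤ → ℤ
heaviside (+ _)    = + 1
heaviside -[1+ _ ] = + 0

heaviside-reflect : ∀ z → heaviside (- + 1 - z) ≡ + 1 - heaviside z
heaviside-reflect (+ zero)  = refl
heaviside-reflect (+ suc n) = refl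
heaviside-reflect -[1+ n ]  = refl

constant : ∀ (g : ℤ → ℤ) → (∀ t → g t ≡ g (t - + 1)) → ∀ k t → g t ≡ g (t - + k)
constant g e zero    t = cong g (sym (+-identityʳ t))
constant g e (suc k) t = trans (e t) (trans (constant g e k (t - + 1)) (cong g (eq t (+ k))))
  where eq : ∀ t k → t - + 1 - k ≡ t - (+ 1 + k)
        eq = solve-∀

-- Multiplication of power series by (1 − x^S)^k as a difference operator

sumTo-cong : ∀ k {f g} → (∀ j → f j ≡ g j) → sumTo k f ≡ sumTo k g
sumTo-cong zero    e = e 0
sumTo-cong (suc k) e = cong₂ _+_ (sumTo-cong k e) (e (suc k))

sumTo-cong-≤ : ∀ k {f g} → (∀ j → j ℕ.≤ k → f j ≡ g j) → sumTo k f ≡ sumTo k g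
sumTo-cong-≤ zero    e = e 0 ℕ.z≤n
sumTo-cong-≤ (suc k) e = cong₂ _+_ (sumTo-cong-≤ k λ j j≤k → e j (ℕₚ.m≤n⇒m≤1+n j≤k)) (e (suc k) ℕₚ.≤-refl)

sumTo-zero : ∀ k {f} → (∀ j → f j ≡ + 0) → sumTo k f ≡ + 0
sumTo-zero zero    e = e 0
sumTo-zero (suc k) e = cong₂ _+_ (sumTo-zero k e) (e (suc k))

sumTo-head : ∀ k {f} → (∀ j → f (suc j) ≡ + 0) → sumTo k f ≡ f 0
sumTo-head zero    e = refl
sumTo-head (suc k) {f} e = trans (cong₂ _+_ (sumTo-head k e) (e k)) (+-identityʳ (f 0))

sumTo-minus : ∀ k f g → sumTo k (λ j → f j - g j) ≡ sumTo k f - sumTo k g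
sumTo-minus zero    f g = refl
sumTo-minus (suc k) f g = trans (cong (_+ (f (suc k) - g (suc k))) (sumTo-minus k f g))
    (eq (sumTo k f) (sumTo k g) (f (suc k)) (g (suc k)))
  where eq : ∀ x y z w → x - y + (z - w) ≡ x + z - (y + w)
        eq = solve-∀

sumTo-suc : ∀ k f → sumTo (suc k) f ≡ f 0 + sumTo k (f ∘ suc)
sumTo-suc zero    f = refl
sumTo-suc (suc k) f = trans (cong (_+ f (suc (suc k))) (sumTo-suc k f)) (+-assoc (f 0) _ _)

sumTo-reverse : ∀ k f → sumTo k f ≡ sumTo k (λ j → f (k ∸ j))
sumTo-reverse zero    f = refl
sumTo-reverse (suc k) f = trans (cong (_+ f (suc k)) (sumTo-reverse k f))
  (trans (+-comm _ (f (suc k))) (sym (sumTo-suc k (λ j → f (suc k ∸ j)))))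

-- Coefficients are placed on all of ℤ so that translations and reflections of the index need no
-- truncated subtraction.
extend : FPS → ℤ → ℤ
extend f (+ n)    = f n
extend f -[1+ _ ] = + 0

extend-zeroBelow : ∀ f → ZeroBelow (+ 0) (extend f)
extend-zeroBelow f (+ n)    t<0 = ⊥-elim (+≮0 t<0)
extend-zeroBelow f -[1+ n ] _   = refl

+-∸ : ∀ {j k} → j ℕ.≤ k → + k - + j ≡ + (k ∸ j)
+-∸ {j} {k} j≤k = trans ([+m]-[+n]≡m⊖n k j) (⊖-≥ j≤k)

module _ (q g : FPS) where

  private
    term : ℤ → ℕ → ℤ
    term z j = extend q (z - + j) * g j

    term-zero : ∀ z j → z < + j → term z j ≡ + 0
    term-zero z j z<j = trans (cong (_* g j) (extend-zeroBelow q (z - + j) lt)) (*-zeroˡ (g j))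
      where lt : z - + j < + 0
            lt = subst (z - + j <_) (+-inverseʳ (+ j)) (+-monoˡ-< (- + j) z<j)

  -- Terms with j > z vanish, so any K ≥ z can serve as upper limit. A common K lets the sums for z
  -- and z - S be subtracted termwise.
  ⊛-as-sum : ∀ K z → z ≤ + K → extend (q ⊛ g) z ≡ sumTo K (λ j → extend q (z - + j) * g j)
  ⊛-as-sum K -[1+ n ] _ = sym (sumTo-zero K λ j → term-zero -[1+ n ] j ℤ.-<+)
  ⊛-as-sum K (+ k) (+≤+ k≤K) = trans base (widen (ℕₚ.≤⇒≤′ k≤K))
    where
      base : (q ⊛ g) k ≡ sumTo k (term (+ k))
      base = trans (sumTo-reverse k (λ j → q j * g (k ∸ j)))
        (sumTo-cong-≤ k λ j j≤k → cong₂ _*_ (cong (extend q) (sym (+-∸ j≤k))) (cong g (ℕₚ.m∸[m∸n]≡n j≤k)))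
      widen : ∀ {K} → k ℕ.≤′ K → sumTo k (term (+ k)) ≡ sumTo K (term (+ k))
      widen (ℕ.≤′-reflexive refl) = refl
      widen (ℕ.≤′-step {n = K} k≤′K) = trans (widen k≤′K) (sym (trans
        (cong (λ w → sumTo K (term (+ k)) + w) (term-zero (+ k) (suc K) (ℤ.+<+ (ℕ.s≤s (ℕₚ.≤′⇒≤ k≤′K)))))
        (+-identityʳ _)))

extend-Δ-⊛ : ∀ S → + 0 ≤ S → ∀ {q q′} → (∀ z → extend q′ z ≡ Δ S (extend q) z) →
  ∀ g z → extend (q′ ⊛ g) z ≡ Δ S (extend (q ⊛ g)) z
extend-Δ-⊛ S 0≤S {q} {q′} e g z = trans (⊛-as-sum q′ g K z z≤K)
  (trans (sumTo-cong K λ j → trans (cong (_* g j) (e (z - + j))) (term j))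
  (trans (sumTo-minus K (λ j → extend q (z - + j) * g j) (λ j → extend q (z - S - + j) * g j))
    (sym (cong₂ _-_ (⊛-as-sum q g K z z≤K) (⊛-as-sum q g K (z - S) z-S≤K)))))
  where
    K = ∣ z ∣
    z≤K : z ≤ + K
    z≤K = self≤abs z
    z-S≤K : z - S ≤ + K
    z-S≤K = ≤-trans (≤-offset S 0≤S (eq z S)) z≤K
      where eq : ∀ z S → z ≡ z - S + S
            eq = solve-∀
    term : ∀ j → Δ S (extend q) (z - + j) * g j ≡ extend q (z - + j) * g j - extend q (z - S - + j) * g j
    term j = trans (distr (extend q (z - + j)) (extend q (z - + j - S)) (g j))
      (cong (λ w → extend q (z - + j) * g j - extend q w * g j) (swap z (+ j) S))
      where distr : ∀ x y w → (x - y) * w ≡ x * w - y * w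
            distr = solve-∀
            swap : ∀ z j S → z - j - S ≡ z - S - j
            swap = solve-∀

oneS-⊛ : ∀ g z → extend (oneS ⊛ g) z ≡ extend g z
oneS-⊛ g -[1+ n ] = refl
oneS-⊛ g (+ k) = trans (sumTo-head k {λ j → oneS j * g (k ∸ j)} λ j → *-zeroˡ (g (k ∸ suc j))) (*-identityˡ (g k))

extend-oneMinusXPow : ∀ S → + 0 ≤ S → ∀ z → extend (oneMinusXPow S) z ≡ Δ S (extend oneS) z
extend-oneMinusXPow S 0≤S -[1+ n ] =
  sym (cong (λ w → + 0 - w) (extend-zeroBelow oneS _ (≤-<-trans (i-j≤i _ S {{ℤ.nonNegative 0≤S}}) ℤ.-<+)))
extend-oneMinusXPow S 0≤S (+ k) with + k ℤ.≟ S
... | yes refl = cong (λ w → oneS k - extend oneS w) (sym (+-inverseʳ S))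
... | no k≢S   = cong (λ w → oneS k - w) (sym (off (+ k - S) (k≢S ∘ i-j≡0⇒i≡j (+ k) S)))
  where off : ∀ w → w ≢ + 0 → extend oneS w ≡ + 0
        off (+ zero)  w≢0 = ⊥-elim (w≢0 refl)
        off (+ suc n) _   = refl
        off -[1+ n ]  _   = refl

extend-^ₛ-⊛ : ∀ k S → + 0 ≤ S → ∀ g z →
  extend ((oneMinusXPow S ^ₛ k) ⊛ g) z ≡ Δ^ k S (extend g) z
extend-^ₛ-⊛ zero    S 0≤S g z = oneS-⊛ g z
extend-^ₛ-⊛ (suc k) S 0≤S g z = trans
  (extend-Δ-⊛ S 0≤S {p ^ₛ k} {p ⊛ (p ^ₛ k)} factor g z)
  (cong₂ _-_ (extend-^ₛ-⊛ k S 0≤S g z) (extend-^ₛ-⊛ k S 0≤S g (z - S)))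
  where
    p = oneMinusXPow S
    factor : ∀ z → extend (p ⊛ (p ^ₛ k)) z ≡ Δ S (extend (p ^ₛ k)) z
    factor z = trans (extend-Δ-⊛ S 0≤S {oneS} {p} (extend-oneMinusXPow S 0≤S) (p ^ₛ k) z)
      (cong₂ _-_ (oneS-⊛ (p ^ₛ k) z) (oneS-⊛ (p ^ₛ k) (z - S)))

-- The map z ↦ d - z exchanges the negative integers with those beyond d, and c is zero on both, so
-- the palindromic identity extends to all of ℤ.
symmetric⇒reflection : ∀ c → SymmetricPoly c → Σ ℤ λ d → ∀ z → extend c z ≡ extend c (d - z)
symmetric⇒reflection c (d , _ , vanish , palin) = + d , reflect
  where
    beyond : ∀ z → + d < z → extend c z ≡ + 0
    beyond (+ k) (ℤ.+<+ d<k) = vanish k d<k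
    reflect : ∀ z → extend c z ≡ extend c (+ d - z)
    reflect -[1+ n ] = sym (beyond _ (<-offset (+ n) (+≤+ ℕ.z≤n) (eq (+ d) (+ n))))
      where eq : ∀ d n → d - - (+ 1 + n) ≡ d + n + + 1
            eq = solve-∀
    reflect (+ k) with k ℕ.≤? d
    ... | yes k≤d = trans (palin k k≤d) (cong (extend c) (sym (+-∸ k≤d)))
    ... | no k≰d  = trans (vanish k (ℕₚ.≰⇒> k≰d)) (sym (extend-zeroBelow c _
            (subst (+ d - + k <_) (+-inverseʳ (+ k)) (+-monoˡ-< (- + k) (ℤ.+<+ (ℕₚ.≰⇒> k≰d))))))

-- The value c 0 = 1 excludes d < 0, where the reflected coefficient would be 0, and its mirror
-- image c d is nonzero, so d is the degree.
reflection⇒symmetric : ∀ c d → c 0 ≡ + 1 → (∀ z → extend c z ≡ extend c (d - z)) → SymmetricPoly c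
reflection⇒symmetric c -[1+ n ] c0≡1 reflect with () ← trans (sym c0≡1) (reflect (+ 0))
reflection⇒symmetric c (+ d) c0≡1 reflect = d , nonzero , vanish , palin
  where
    palin : ∀ k → k ℕ.≤ d → c k ≡ c (d ∸ k)
    palin k k≤d = trans (reflect (+ k)) (cong (extend c) (+-∸ k≤d))
    nonzero : c d ≢ + 0
    nonzero cd≡0 with () ← trans (sym c0≡1) (trans (palin 0 ℕ.z≤n) cd≡0)
    vanish : ∀ k → d ℕ.< k → c k ≡ + 0
    vanish k d<k = trans (reflect (+ k)) (extend-zeroBelow c _
      (subst (+ d - + k <_) (+-inverseʳ (+ k)) (+-monoˡ-< (- + k) (ℤ.+<+ d<k))))

-- Since S ≥ 1, every shifted term is evaluated below 0. This yields the constant coefficient 1 of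
-- the h*-vector.
Δ^-at-0 : ∀ k S {g} → + 1 ≤ S → ZeroBelow (+ 0) g → Δ^ k S g (+ 0) ≡ g (+ 0)
Δ^-at-0 zero    S 1≤S z = refl
Δ^-at-0 (suc k) S {g} 1≤S z = trans
  (cong₂ _-_ (Δ^-at-0 k S 1≤S z) (Δ^-zeroBelow k S (≤-trans (+≤+ ℕ.z≤n) 1≤S) z (+ 0 - S)
    (<-offset (S - + 1) (i≤j⇒0≤j-i 1≤S) (eq S))))
  (+-identityʳ (g (+ 0)))
  where eq : ∀ S → + 0 ≡ + 0 - S + (S - + 1) + + 1
        eq = solve-∀

ZeroBelow-shift : ∀ {t₀ g} c → ZeroBelow t₀ g → ZeroBelow (t₀ + c) (λ t → g (t - c))
ZeroBelow-shift {t₀} c z t t< = z (t - c) (subst (t - c <_) (eq t₀ c) (+-monoˡ-< (- c) t<))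
  where eq : ∀ t c → t + c - c ≡ t
        eq = solve-∀

ZeroBelow-≤ : ∀ {t₀ t₁ g} → t₁ ≤ t₀ → ZeroBelow t₀ g → ZeroBelow t₁ g
ZeroBelow-≤ t₁≤t₀ z t t< = z t (<-≤-trans t< t₁≤t₀)

step-mono : ∀ {g : ℤ → ℤ} → (∀ t → g (t - + 1) ≤ g t) → ∀ {x y} → x ≤ y → g x ≤ g y
step-mono {g} st {x} {y} x≤y = subst (λ w → g w ≤ g y) (trans (cong (λ w → y - w) (0≤i⇒+∣i∣≡i (i≤j⇒0≤j-i x≤y))) (eq x y)) (below ∣ y - x ∣ y)
  where
    eq : ∀ x y → y - (y - x) ≡ x
    eq = solve-∀
    eq′ : ∀ y k → y - + 1 - k ≡ y - (+ 1 + k)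
    eq′ = solve-∀
    below : ∀ k y → g (y - + k) ≤ g y
    below zero    y = ≤-reflexive (cong g (+-identityʳ y))
    below (suc k) y = ≤-trans (subst (λ w → g w ≤ g (y - + 1)) (eq′ y (+ k)) (below k (y - + 1))) (st y)

squeeze : ∀ {q r} → q ≤ r → r ≤ q + + 1 → r ≡ q ⊎ r ≡ q + + 1
squeeze {q} {r} q≤r r≤ with dichotomy r q
... | inj₁ r≤q = inj₁ (≤-antisym r≤q q≤r)
... | inj₂ q<r = inj₂ (≤-antisym r≤ (≤-trans (≤-reflexive (+-comm q (+ 1))) (<⇒1+≤ q<r)))

floor-step : ∀ x {a} d .{{_ : ℕ.NonZero d}} → + 0 ≤ a → a ≤ + d →
  (x + a) /ℕ d ≡ x /ℕ d ⊎ (x + a) /ℕ d ≡ x /ℕ d + + 1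
floor-step x {a} d 0≤a a≤d = squeeze
  (floor-mono {x} {x + a} d (≤-offset a 0≤a refl))
  (≤-trans (floor-mono d (+-monoʳ-≤ x (≤-trans a≤d (≤-reflexive (sym (*-identityˡ (+ d)))))))
    (≤-reflexive (floor-+ x (+ 1) d)))

-- Reciprocity and the Gorenstein condition

module Lattice (μ : ℕ → ℕ) where

  m : ℕ → ℕ
  m n = suc (μ n)

  -- With s_n = m n for n ≥ 1, L 0 n t and L 1 n t count the lattice points with last coordinate ≤ t in the
  -- closed cone and in its interior; slice e n t counts those in dimension n + 1 with last coordinate t.
  -- The value m 0, which has no counterpart in s (s_0 = 0), does not influence L 0, but L 1 has this
  -- meaning only for m 0 = 1.
  slice : ℕ → ℕ → ℤ → ℤ
  L : ℕ → ℕ → ℤ → ℤ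

  L e zero    = heaviside
  L e (suc n) = Σ⁺ (slice e n)

  slice e n t = L e n ((t * + m n - + e) /ℕ m (suc n))

  L-zeroBelow : ∀ e n → ZeroBelow (+ 0) (L e n)
  L-zeroBelow e zero    (+ n)    t<0 = ⊥-elim (+≮0 t<0)
  L-zeroBelow e zero    -[1+ n ] _   = refl
  L-zeroBelow e (suc n) = Σ⁺-zeroBelow (slice e n)

  slice-zeroBelow : ∀ e n → ZeroBelow (+ 0) (slice e n)
  slice-zeroBelow e n t t<0 = L-zeroBelow e n _ (≰⇒> λ 0≤fl →
    <⇒≱ neg (≤floor⇒*≤ (m (suc n)) 0≤fl))
    where
      neg : t * + m n - + e < + 0
      neg = ≤-<-trans (i-j≤i (t * + m n) (+ e)) (*-monoʳ-<-pos (+ m n) t<0)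

  -- The inductive hypothesis identifies the first differences of U and V up to reflection, so that E is
  -- constant; comparing E z with E (z - M) gives the claim.
  reciprocity : ∀ n z →
    Δ^ (suc n) (+ m n) (L 0 n) z ≡ Δ^ (suc n) (+ m n) (L 1 n) (+ suc n * + m n - + 1 - z)
  reciprocity zero z = sym (trans
    (cong₂ (λ x y → heaviside x - heaviside y) (eq₁ (+ m 0) z) (eq₂ (+ m 0) z))
    (trans (cong₂ _-_ (heaviside-reflect (z - + m 0)) (heaviside-reflect z))
      (eq₃ (heaviside (z - + m 0)) (heaviside z))))
    where
      eq₁ : ∀ a z → + 1 * a - + 1 - z ≡ - + 1 - (z - a)
      eq₁ = solve-∀
      eq₂ : ∀ a z → + 1 * a - + 1 - z - a ≡ - + 1 - z
      eq₂ = solve-∀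
      eq₃ : ∀ x y → + 1 - x - (+ 1 - y) ≡ y - x
      eq₃ = solve-∀
  reciprocity (suc n) z = trans (eq₁ (U z) (U (z - M)) (V (N * M - + 1 - z)))
      (trans (cong (λ x → x - U (z - M) - V (N * M - + 1 - z)) (constant E E-step (m (suc n)) z))
        (trans (eq₂ (U (z - M)) _ _) (cong₂ (λ x y → V x - V y) (eq₃ N M z) (eq₄ N M z))))
    where
      N = + suc n
      M = + m (suc n)
      a = + m n
      U = Δ^ (suc n) M (L 0 (suc n))
      V = Δ^ (suc n) M (L 1 (suc n))
      E : ℤ → ℤ
      E t = U t + V (N * M - + 1 - t)
      ΔL : ∀ e t → Δ (+ 1) (Δ^ (suc n) M (L e (suc n))) t ≡ Δ^ (suc n) a (L e n) ((t * a - + e) /ℕ m (suc n))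
      ΔL e t = trans (Δ-Δ^-comm (suc n) (+ 1) M (L e (suc n)) t)
        (trans (Δ^-cong (suc n) M (Δ-Σ⁺ (slice-zeroBelow e n)) t)
          (Δ^-floor (suc n) a (+ e) (m (suc n)) (L e n) t))
      reflect : ∀ t → N * a - + 1 - (t * a - + 0) /ℕ m (suc n) ≡ ((N * M - t) * a - + 1) /ℕ m (suc n)
      reflect t = sym (trans (cong (_/ℕ m (suc n)) (eq N M a t))
        (trans (floor-+ (- (t * a - + 0) - + 1) (N * a) (m (suc n)))
          (trans (cong (_+ N * a) (floor-neg (t * a - + 0) (m (suc n))))
            (eq′ (N * a) ((t * a - + 0) /ℕ m (suc n))))))
        where eq : ∀ N M a t → (N * M - t) * a - + 1 ≡ - (t * a - + 0) - + 1 + N * a * M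
              eq = solve-∀
              eq′ : ∀ x y → - + 1 - y + x ≡ x - + 1 - y
              eq′ = solve-∀
      ΔU≡ΔV : ∀ t → Δ (+ 1) U t ≡ Δ (+ 1) V (N * M - t)
      ΔU≡ΔV t = trans (ΔL 0 t) (trans (reciprocity n _)
        (trans (cong (Δ^ (suc n) a (L 1 n)) (reflect t)) (sym (ΔL 1 (N * M - t)))))
      E-step : ∀ t → E t ≡ E (t - + 1)
      E-step t = trans (split (U t) (U (t - + 1)) (V (N * M - + 1 - t)))
        (trans (cong (λ x → U (t - + 1) + x + V (N * M - + 1 - t)) (ΔU≡ΔV t))
        (trans (cong₂ (λ x y → U (t - + 1) + (V (N * M - t) - V x) + V y)
                 (e₁ N M t) refl)
        (trans (cancel (U (t - + 1)) (V (N * M - t)) (V (N * M - + 1 - t)))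
          (cong (λ x → U (t - + 1) + V x) (e₂ N M t)))))
        where
          split : ∀ x y z → x + z ≡ y + (x - y) + z
          split = solve-∀
          cancel : ∀ x y z → x + (y - z) + z ≡ x + y
          cancel = solve-∀
          e₁ : ∀ N M t → N * M - t - + 1 ≡ N * M - + 1 - t
          e₁ = solve-∀
          e₂ : ∀ N M t → N * M - t ≡ N * M - + 1 - (t - + 1)
          e₂ = solve-∀
      eq₁ : ∀ x y z → x - y ≡ x + z - y - z
      eq₁ = solve-∀
      eq₂ : ∀ x y z → x + y - x - z ≡ y - z
      eq₂ = solve-∀
      eq₃ : ∀ N M z → N * M - + 1 - (z - M) ≡ (+ 1 + N) * M - + 1 - z
      eq₃ = solve-∀
      eq₄ : ∀ N M z → N * M - + 1 - z ≡ (+ 1 + N) * M - + 1 - z - M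
      eq₄ = solve-∀

  -- Numerical form of the Gorenstein property of a cone, whose interior lattice points are a
  -- translate of all its lattice points; only the counts by last coordinate are compared.
  Gorenstein : ℕ → ℤ → Set
  Gorenstein n c = ∀ t → L 1 n t ≡ L 0 n (t - c)

  L-at-0 : ∀ n → L 0 n (+ 0) ≡ + 1
  L-at-0 zero    = refl
  L-at-0 (suc n) = L-at-0 n

  1≤m : ∀ n → + 1 ≤ + m n
  1≤m n = +≤+ (ℕ.s≤s ℕ.z≤n)

  module _ (n : ℕ) (h : FPS)
    (extend-h : ∀ z → extend h z ≡ Δ^ (suc n) (+ m n) (L 0 n) z) where

    private
      top = + suc n * + m n - + 1

    -- Reciprocity followed by the reflection of h is a translation by c = `top` - d, so the
    -- iterated differences of `L 1` and of the translated `L 0` agree; `Δ^-injective` removes the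
    -- differences.
    symmetric⇒Gorenstein : SymmetricPoly h → Σ ℤ (Gorenstein n)
    symmetric⇒Gorenstein sym-h with symmetric⇒reflection h sym-h
    ... | d , reflect = c , Δ^-injective (suc n) (+ m n) {t₀ = t₀} (1≤m n)
           (λ t t< → L-zeroBelow 1 n t (<-≤-trans t< (i⊓j≤i (+ 0) c)))
           (λ t t< → L-zeroBelow 0 n (t - c)
             (subst (t - c <_) (+-inverseʳ c) (+-monoˡ-< (- c) (<-≤-trans t< (i⊓j≤j (+ 0) c)))))
           (λ t → trans (cong D₁ (sym (e₁ top t))) (trans (sym (reciprocity n (top - t)))
             (trans (sym (extend-h (top - t))) (trans (reflect (top - t)) (trans (extend-h (d - (top - t)))
             (trans (cong (Δ^ (suc n) (+ m n) (L 0 n)) (e₂ top d t)) (sym (Δ^-shift (suc n) (+ m n) (L 0 n) c t))))))))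
      where
        c  = top - d
        -- The sign of c is unknown here; below this minimum both `L 1` and the translate of `L 0`
        -- vanish.
        t₀ = + 0 ℤ.⊓ c
        D₁ = Δ^ (suc n) (+ m n) (L 1 n)
        e₁ : ∀ T t → T - (T - t) ≡ t
        e₁ = solve-∀
        e₂ : ∀ T d t → d - (T - t) ≡ t - (T - d)
        e₂ = solve-∀

    Gorenstein⇒symmetric : ∀ {c} → Gorenstein n c → SymmetricPoly h
    Gorenstein⇒symmetric {c} gor = reflection⇒symmetric h (top - c)
      (trans (extend-h (+ 0)) (trans (Δ^-at-0 (suc n) (+ m n) (1≤m n) (L-zeroBelow 0 n)) (L-at-0 n)))
      λ z → trans (extend-h z) (trans (reciprocity n z) (trans (Δ^-cong (suc n) (+ m n) gor (top - z))
        (trans (Δ^-shift (suc n) (+ m n) (L 0 n) c (top - z))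
          (trans (cong (Δ^ (suc n) (+ m n) (L 0 n)) (e top c z)) (sym (extend-h (top - c - z)))))))
      where
        e : ∀ T c z → T - z - c ≡ T - c - z
        e = solve-∀

  Gorenstein-slice : ∀ n {c} → Gorenstein (suc n) c → ∀ t → slice 1 n t ≡ slice 0 n (t - c)
  Gorenstein-slice n {c} gor t = trans (sym (Δ-Σ⁺ (slice-zeroBelow 1 n) t))
    (trans (Δ^-cong 1 (+ 1) gor t) (trans (Δ^-shift 1 (+ 1) (L 0 (suc n)) c t) (Δ-Σ⁺ (slice-zeroBelow 0 n) (t - c))))

  slice-Gorenstein : ∀ n {c} → (∀ t → slice 1 n t ≡ slice 0 n (t - c)) → Gorenstein (suc n) c
  slice-Gorenstein n {c} e = Δ-injective (+ 1) {t₀ = + 0 ℤ.⊓ (+ 0 + c)} ≤-refl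
    (ZeroBelow-≤ (i⊓j≤i (+ 0) (+ 0 + c)) (L-zeroBelow 1 (suc n)))
    (ZeroBelow-≤ (i⊓j≤j (+ 0) (+ 0 + c)) (ZeroBelow-shift c (L-zeroBelow 0 (suc n))))
    (λ t → trans (Δ-Σ⁺ (slice-zeroBelow 1 n) t) (trans (e t)
      (trans (sym (Δ-Σ⁺ (slice-zeroBelow 0 n) (t - c))) (sym (Δ^-shift 1 (+ 1) (L 0 (suc n)) c t)))))

  Gorenstein-zero : Gorenstein 0 (+ 0)
  Gorenstein-zero t = cong heaviside (sym (+-identityʳ t))

  -- The equation turns t m_n - 1 - c′ m_{n+1} into (t - c) m_n, so the two floors differ by exactly
  -- the translation c′ of the lower dimension.
  Gorenstein-suc : ∀ n {c c′} → c * + m n ≡ c′ * + m (suc n) + + 1 → Gorenstein n c′ → Gorenstein (suc n) c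
  Gorenstein-suc n {c} {c′} e gor = slice-Gorenstein n λ t → trans (gor _)
    (cong (L 0 n) (trans (sym (floor-+ (t * + m n - + 1) (- c′) (m (suc n))))
      (cong (_/ℕ m (suc n)) (shift t))))
    where
      shift : ∀ t → t * + m n - + 1 + - c′ * + m (suc n) ≡ (t - c) * + m n - + 0
      shift t = trans (eq₁ t (+ m n) c′ (+ m (suc n))) (trans (cong (λ w → t * + m n - w) (sym e)) (eq₂ t (+ m n) c))
        where eq₁ : ∀ t a c′ M → t * a - + 1 + - c′ * M ≡ t * a - (c′ * M + + 1)
              eq₁ = solve-∀
              eq₂ : ∀ t a c → t * a - c * a ≡ (t - c) * a - + 0
              eq₂ = solve-∀

  L-nonneg : ∀ e n t → + 0 ≤ L e n t
  L-nonneg e zero    (+ _)    = +≤+ ℕ.z≤n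
  L-nonneg e zero    -[1+ _ ] = ≤-refl
  L-nonneg e (suc n) -[1+ _ ] = ≤-refl
  L-nonneg e (suc n) (+ zero)  = L-nonneg e n _
  L-nonneg e (suc n) (+ suc k) = 0≤-+ (L-nonneg e (suc n) (+ k)) (L-nonneg e n _)

  L-suc : ∀ e n t → L e (suc n) t ≡ L e (suc n) (t - + 1) + slice e n t
  L-suc e n = Σ⁺-step (slice-zeroBelow e n)

  L-mono : ∀ e n {x y} → x ≤ y → L e n x ≤ L e n y
  L-mono e (suc n) = step-mono λ t → ≤-offset (slice e n t) (L-nonneg e n _) (L-suc e n t)
  L-mono e zero {+ _}      {+ _}      _ = ≤-refl
  L-mono e zero { -[1+ _ ]} {y}       _ = L-nonneg 0 zero y

  slice-mono : ∀ e n {x y} → x ≤ y → slice e n x ≤ slice e n y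
  slice-mono e n x≤y = L-mono e n (floor-mono (m (suc n)) (+-monoˡ-≤ (- + e) (*-monoʳ-≤-nonNeg (+ m n) x≤y)))

  L-0-pos : ∀ n t → + 0 ≤ t → + 1 ≤ L 0 n t
  L-0-pos n t 0≤t = ≤-trans (≤-reflexive (sym (L-at-0 n))) (L-mono 0 n 0≤t)

  L-0-strict : ∀ n t → + 0 ≤ t → L 0 (suc n) (t - + 1) < L 0 (suc n) t
  L-0-strict n t 0≤t = <-offset (slice 0 n t - + 1) (i≤j⇒0≤j-i 1≤slice)
      (trans (L-suc 0 n t) (eq (L 0 (suc n) (t - + 1)) (slice 0 n t)))
    where
      1≤slice : + 1 ≤ slice 0 n t
      1≤slice = ≤-trans (≤-reflexive (sym (L-at-0 n))) (slice-mono 0 n 0≤t)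
      eq : ∀ x y → x + y ≡ x + (y - + 1) + + 1
      eq = solve-∀

  L-≤0 : ∀ e n t → slice e n t ≤ + 0 → L e (suc n) t ≤ + 0
  L-≤0 e n -[1+ _ ]  _  = ≤-refl
  L-≤0 e n (+ zero)  s≤ = s≤
  L-≤0 e n (+ suc k) s≤ = +-mono-≤
    (L-≤0 e n (+ k) (≤-trans (slice-mono e n (+≤+ (ℕₚ.n≤1+n k))) s≤)) s≤

  -- Slices grow with t, so a positive sum up to t forces the slice at t, and then the one at t + 1,
  -- to be positive. Positivity is assumed because `L 1` can be constantly 0 at first.
  L-strict : ∀ e n t → + 0 < L e (suc n) t → L e (suc n) t < L e (suc n) (t + + 1)
  L-strict e n t 0<L with dichotomy (slice e n t) (+ 0)
  ... | inj₁ s≤0 = ⊥-elim (<⇒≱ 0<L (L-≤0 e n t s≤0))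
  ... | inj₂ 0<s = subst₂ _<_ (+-identityʳ _) (sym (trans (L-suc e n (t + + 1)) (cong (λ w → L e (suc n) w + slice e n (t + + 1)) (eq t))))
        (+-monoʳ-< (L e (suc n) t) (<-≤-trans 0<s (slice-mono e n {t} {t + + 1} (≤-offset (+ 1) (+≤+ ℕ.z≤n) refl))))
    where eq : ∀ t → t + + 1 - + 1 ≡ t
          eq = solve-∀

  module _ (n : ℕ) {c : ℤ} (gor : Gorenstein (suc (suc n)) c) (m≤m : + m (suc n) ≤ + m (suc (suc n))) where

    private
      d = m (suc (suc n))
      a = + m (suc n)
      M = + d
      U V : ℤ → ℤ
      -- U and V are the floors at which `slice` evaluates `L 1` at height c + x and `L 0` at height
      -- x.
      U x = ((c + x) * a - + 1) /ℕ d
      V x = (x * a - + 0) /ℕ d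

      counts : ∀ x → L 1 (suc n) (U x) ≡ L 0 (suc n) (V x)
      counts x = trans (Gorenstein-slice (suc n) gor (c + x)) (cong (slice 0 (suc n)) (eq c x))
        where eq : ∀ c x → c + x - c ≡ x
              eq = solve-∀

    -- As V 0 = 0, this is the only constant by which U can differ from V.
    shiftDown : ℤ
    shiftDown = U (+ 0)

    private
      c′ = shiftDown

      U-step : ∀ x → U (x + + 1) ≡ U x ⊎ U (x + + 1) ≡ U x + + 1
      U-step x = subst (λ w → w /ℕ d ≡ U x ⊎ w /ℕ d ≡ U x + + 1) (eq c x a)
          (floor-step ((c + x) * a - + 1) d (+≤+ ℕ.z≤n) m≤m)
        where eq : ∀ c x a → (c + x) * a - + 1 + a ≡ (c + (x + + 1)) * a - + 1
              eq = solve-∀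

      V-step : ∀ x → V (x + + 1) ≡ V x ⊎ V (x + + 1) ≡ V x + + 1
      V-step x = subst (λ w → w /ℕ d ≡ V x ⊎ w /ℕ d ≡ V x + + 1) (eq x a)
          (floor-step (x * a - + 0) d (+≤+ ℕ.z≤n) m≤m)
        where eq : ∀ x a → x * a - + 0 + a ≡ (x + + 1) * a - + 0
              eq = solve-∀

      V-nonneg : ∀ {x} → + 0 ≤ x → + 0 ≤ V x
      V-nonneg {x} 0≤x = *≤⇒≤floor d (subst (+ 0 ≤_) (sym (+-identityʳ (x * a))) (0≤-* 0≤x (+≤+ ℕ.z≤n)))

      -- Both steps are 0 or 1, and L 0, L 1 are strictly increasing where positive, so that
      -- counts forces U and V to jump at the same places.
      U≡V-step : ∀ x → + 0 ≤ x → U x ≡ V x + c′ → U (x + + 1) ≡ V (x + + 1) + c′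
      U≡V-step x 0≤x e with U-step x | V-step x
      ... | inj₁ u | inj₁ v = trans u (trans e (cong (_+ c′) (sym v)))
      ... | inj₂ u | inj₂ v = trans u (trans (cong (_+ + 1) e) (trans (eq (V x) c′) (cong (_+ c′) (sym v))))
        where eq : ∀ v c → v + c + + 1 ≡ v + + 1 + c
              eq = solve-∀
      ... | inj₁ u | inj₂ v = ⊥-elim (<-irrefl same
            (subst (λ w → L 0 (suc n) w < L 0 (suc n) (V x + + 1)) (eq (V x))
              (L-0-strict n (V x + + 1) (0≤-+ (V-nonneg 0≤x) (+≤+ ℕ.z≤n)))))
        where eq : ∀ v → v + + 1 - + 1 ≡ v
              eq = solve-∀
              same : L 0 (suc n) (V x) ≡ L 0 (suc n) (V x + + 1)
              same = trans (sym (counts x)) (trans (cong (L 1 (suc n)) (sym u))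
                (trans (counts (x + + 1)) (cong (L 0 (suc n)) v)))
      ... | inj₂ u | inj₁ v = ⊥-elim (<-irrefl same (L-strict 1 n (U x)
            (subst (+ 0 <_) (sym (counts x)) (1+≤⇒< (L-0-pos (suc n) (V x) (V-nonneg 0≤x))))))
        where same : L 1 (suc n) (U x) ≡ L 1 (suc n) (U x + + 1)
              same = trans (counts x) (trans (cong (L 0 (suc n)) (sym v))
                (trans (sym (counts (x + + 1))) (cong (L 1 (suc n)) u)))

      U≡V-nonneg : ∀ k → U (+ k) ≡ V (+ k) + c′
      U≡V-nonneg zero    = sym (+-identityˡ c′)
      U≡V-nonneg (suc k) = subst (λ w → U w ≡ V w + c′) (+-comm (+ k) (+ 1))
        (U≡V-step (+ k) (+≤+ ℕ.z≤n) (U≡V-nonneg k))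

      U-period : ∀ x k → U (x + k * M) ≡ U x + k * a
      U-period x k = trans (cong (_/ℕ d) (eq c x k M a)) (floor-+ ((c + x) * a - + 1) (k * a) d)
        where eq : ∀ c x k M a → (c + (x + k * M)) * a - + 1 ≡ (c + x) * a - + 1 + k * a * M
              eq = solve-∀

      V-period : ∀ x k → V (x + k * M) ≡ V x + k * a
      V-period x k = trans (cong (_/ℕ d) (eq x k M a)) (floor-+ (x * a - + 0) (k * a) d)
        where eq : ∀ x k M a → (x + k * M) * a - + 0 ≡ x * a - + 0 + k * a * M
              eq = solve-∀

      -- Replacing x by x + k M adds k a to both floors, which carries the identity from nonnegative
      -- to all x.
      U≡V : ∀ x → U x ≡ V x + c′
      U≡V x = AbelianGroup.∙-cancelʳ +-0-abelianGroup (k * a) (U x) (V x + c′) (trans (sym (U-period x k))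
          (trans (subst (λ w → U w ≡ V w + c′) (0≤i⇒+∣i∣≡i 0≤y) (U≡V-nonneg ∣ x + k * M ∣))
            (trans (cong (_+ c′) (V-period x k)) (eq (V x) (k * a) c′))))
        where
          -- Large enough because M ≥ 1.
          k = + ∣ - x ∣
          0≤y : + 0 ≤ x + k * M
          0≤y = subst (+ 0 ≤_) (eq′ x k (+ μ (suc (suc n))))
            (0≤-+ (i≤j⇒0≤j-i (self≤abs (- x))) (0≤-* {k} {+ μ (suc (suc n))} (+≤+ ℕ.z≤n) (+≤+ ℕ.z≤n)))
            where eq′ : ∀ x k u → k - - x + k * u ≡ x + k * (+ 1 + u)
                  eq′ = solve-∀
          eq : ∀ v ka c → v + ka + c ≡ v + c + ka
          eq = solve-∀

      -- Since a ≤ M, the values ⌊x a / M⌋ skip no integer; the witness is the ceiling of y M / a.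
      V-surjective : ∀ y → Σ ℤ λ x → V x ≡ y
      V-surjective y = - q , floor-unique d
          (≤-offset _ (i≤j⇒0≤j-i ([n/ℕd]*d≤n (- (y * M)) (m (suc n)))) (eq₁ q a y M))
          (<-offset _ (0≤-+ (0≤gap (n<s[n/ℕd]*d (- (y * M)) (m (suc n)))) (i≤j⇒0≤j-i m≤m)) (eq₂ q a y M))
        where
          q = - (y * M) /ℕ m (suc n)
          eq₁ : ∀ q a y M → - q * a - + 0 ≡ y * M + (- (y * M) - q * a)
          eq₁ = solve-∀
          eq₂ : ∀ q a y M → (+ 1 + y) * M ≡ - q * a - + 0 + ((+ 1 + q) * a - - (y * M) - + 1 + (M - a)) + + 1
          eq₂ = solve-∀

    Gorenstein-pred : Gorenstein (suc n) shiftDown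
    Gorenstein-pred t with V-surjective (t - c′)
    ... | x , Vx≡ = trans (cong (L 1 (suc n)) (trans (eq t c′) (trans (cong (_+ c′) (sym Vx≡)) (sym (U≡V x)))))
        (trans (counts x) (cong (L 0 (suc n)) Vx≡))
      where eq : ∀ t c → t ≡ t - c + c
            eq = solve-∀

    1≤weight : + 1 ≤ c * a - shiftDown * M
    1≤weight = ≤-offset _ (i≤j⇒0≤j-i ([n/ℕd]*d≤n ((c + + 0) * a - + 1) d)) (eq c a c′ M)
      where eq : ∀ c a c′ M → c * a - c′ * M ≡ + 1 + ((c + + 0) * a - + 1 - c′ * M)
            eq = solve-∀

    -- The hypothesis says q ≤ ⌊(t a - 1)/M⌋, which is U (t - c). By `U≡V` this becomes q - c′ ≤ V
    -- (t - c), that is (q - c′) M ≤ (t - c) a. So the weight is the least positive integral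
    -- combination of a and M.
    weight-minimal : ∀ t q → + 1 ≤ t * a - q * M → c * a - shiftDown * M ≤ t * a - q * M
    weight-minimal t q 1≤z = ≤-offset _ (i≤j⇒0≤j-i (≤floor⇒*≤ {q - c′} {(t - c) * a - + 0} d q-c′≤V)) (eq t a q M c c′)
      where
        eq : ∀ t a q M c c′ → t * a - q * M ≡ c * a - c′ * M + ((t - c) * a - + 0 - (q - c′) * M)
        eq = solve-∀
        e₁ : ∀ c t a q M → (c + (t - c)) * a - + 1 ≡ q * M + (t * a - q * M - + 1)
        e₁ = solve-∀
        q≤U : q ≤ U (t - c)
        q≤U = *≤⇒≤floor d (≤-offset _ (i≤j⇒0≤j-i 1≤z) (e₁ c t a q M))
        q-c′≤V : q - c′ ≤ V (t - c)
        q-c′≤V = subst (q - c′ ≤_) (trans (cong (_- c′) (U≡V (t - c))) (e₂ (V (t - c)) c′)) (+-monoˡ-≤ (- c′) q≤U)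
          where e₂ : ∀ v c → v + c - c ≡ v
                e₂ = solve-∀

-- Enumeration of the lattice points

-- Duplicate-free lists with the same members are permutations of each other.
IsCount-unique : ∀ {A : Set} {P : A → Set} {c d} → IsCount P c → IsCount P d → c ≡ d
IsCount-unique (xs , uxs , xs-P , refl) (ys , uys , ys-P , refl) =
  ↭-length (∼bag⇒↭ (unique∧set⇒bag uxs uys (mk⇔
    (λ x∈ → proj₂ (ys-P _) (proj₁ (xs-P _) x∈)) (λ y∈ → proj₂ (xs-P _) (proj₁ (ys-P _) y∈)))))

module _ {A : Set} where

  layers : (ℕ → List A) → ℕ → List A
  layers f zero    = f 0
  layers f (suc k) = layers f k ++ f (suc k)

  length-layers : ∀ f k → + length (layers f k) ≡ sumTo k (λ j → + length (f j))
  length-layers f zero    = refl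
  length-layers f (suc k) = trans (cong +_ (length-++ (layers f k)))
    (trans (pos-+ (length (layers f k)) _) (cong (_+ + length (f (suc k))) (length-layers f k)))

  ∈-layers⁻ : ∀ f k {x} → x ∈ layers f k → Σ ℕ λ j → j ℕ.≤ k × x ∈ f j
  ∈-layers⁻ f zero    x∈ = 0 , ℕ.z≤n , x∈
  ∈-layers⁻ f (suc k) x∈ with ∈-++⁻ (layers f k) x∈
  ... | inj₂ x∈k = suc k , ℕₚ.≤-refl , x∈k
  ... | inj₁ x∈l with ∈-layers⁻ f k x∈l
  ...   | j , j≤k , x∈j = j , ℕₚ.m≤n⇒m≤1+n j≤k , x∈j

  ∈-layers⁺ : ∀ f {j k x} → j ℕ.≤′ k → x ∈ f j → x ∈ layers f k
  ∈-layers⁺ f {k = zero}  (ℕ.≤′-reflexive refl) x∈ = x∈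
  ∈-layers⁺ f {k = suc k} (ℕ.≤′-reflexive refl) x∈ = ∈-++⁺ʳ (layers f k) x∈
  ∈-layers⁺ f {k = suc k} (ℕ.≤′-step j≤k)       x∈ = ∈-++⁺ˡ (∈-layers⁺ f j≤k x∈)

  layers-unique : ∀ f → (∀ j → Unique (f j)) → (∀ {i j x} → x ∈ f i → x ∈ f j → i ≡ j) →
    ∀ k → Unique (layers f k)
  layers-unique f uf sep zero    = uf 0
  layers-unique f uf sep (suc k) = Unique.++⁺ (layers-unique f uf sep k) (uf (suc k)) disjoint
    where
      disjoint : ∀ {x} → ¬ (x ∈ layers f k × x ∈ f (suc k))
      disjoint (x∈l , x∈k) with ∈-layers⁻ f k x∈l
      ... | j , j≤k , x∈j = ℕₚ.<⇒≢ (ℕ.s≤s j≤k) (sep x∈j x∈k)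

last′ : ∀ {n} → ℤ → Vec ℤ n → ℤ
last′ a []      = a
last′ a (b ∷ v) = last′ b v

last′-∷ʳ : ∀ {n} a (v : Vec ℤ n) x → last′ a (v ∷ʳ x) ≡ x
last′-∷ʳ a []      x = refl
last′-∷ʳ a (b ∷ v) x = last′-∷ʳ b v x

LastLe-∷ : ∀ {n} a (v : Vec ℤ n) T → LastLe (a ∷ v) T ≡ (last′ a v ≤ T)
LastLe-∷ a []      T = refl
LastLe-∷ a (b ∷ v) T = LastLe-∷ b v T

LastLe-∷ʳ : ∀ {n} (v : Vec ℤ n) x T → LastLe (v ∷ʳ x) T ≡ (x ≤ T)
LastLe-∷ʳ []      x T = refl
LastLe-∷ʳ (a ∷ v) x T = trans (LastLe-∷ a (v ∷ʳ x) T) (cong (_≤ T) (last′-∷ʳ a v x))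

module _ (s : ℕ → ℤ) where

  -- The cone conditions recurse from the front of the vector, the recursion for `L` from its end.
  -- This lemma and its converse mediate between the two.
  ChainFrom-∷ʳ⁻ : ∀ {k} i a (v : Vec ℤ k) x → ChainFrom s i a (v ∷ʳ x) →
    ChainFrom s i a v × (last′ a v * s (suc (i ℕ.+ k)) ≤ x * s (i ℕ.+ k))
  ChainFrom-∷ʳ⁻ {zero} i a [] x (le , _) rewrite ℕₚ.+-identityʳ i = tt , le
  ChainFrom-∷ʳ⁻ {suc k} i a (b ∷ v) x (le , ch) with ChainFrom-∷ʳ⁻ (suc i) b v x ch
  ... | ch′ , le′ rewrite ℕₚ.+-suc i k = (le , ch′) , le′

  ChainFrom-∷ʳ⁺ : ∀ {k} i a (v : Vec ℤ k) x → ChainFrom s i a v →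
    last′ a v * s (suc (i ℕ.+ k)) ≤ x * s (i ℕ.+ k) → ChainFrom s i a (v ∷ʳ x)
  ChainFrom-∷ʳ⁺ {zero} i a [] x _ le rewrite ℕₚ.+-identityʳ i = le , tt
  ChainFrom-∷ʳ⁺ {suc k} i a (b ∷ v) x (le , ch) le′ rewrite ℕₚ.+-suc i k =
    le , ChainFrom-∷ʳ⁺ (suc i) b v x ch le′

module Counting (μ : ℕ → ℕ) (s : ℕ → ℤ) (s-suc : ∀ n → s (suc n) ≡ + suc (μ (suc n))) where
  open Lattice μ

  0≤chain-step : ∀ i {a x} → + 0 ≤ a → a * s (suc (suc i)) ≤ x * s (suc i) → + 0 ≤ x
  0≤chain-step i {a} {x} 0≤a le rewrite s-suc i | s-suc (suc i) =
    *-cancelʳ-≤-pos (+ 0) x (+ m (suc i)) (≤-trans (0≤-* 0≤a (+≤+ ℕ.z≤n)) le)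

  0≤last′ : ∀ {k} i a (v : Vec ℤ k) → + 0 ≤ a → ChainFrom s (suc i) a v → + 0 ≤ last′ a v
  0≤last′ i a []      0≤a _ = 0≤a
  0≤last′ i a (b ∷ v) 0≤a (le , ch) = 0≤last′ (suc i) b v (0≤chain-step i {a} 0≤a le) ch

  -- For n ≥ 1, the largest λ_n compatible with λ_{n+1} = x.
  section : ∀ n → ℤ → ℤ
  section n x = (x * + m n - + 0) /ℕ m (suc n)

  Cone : ∀ n → ℤ → Vec ℤ n → Set
  Cone n T v = InCone s v × LastLe v T

  chain⇔floor : ∀ n l x → (l * s (suc (suc n)) ≤ x * s (suc n)) ⇔ (l ≤ section (suc n) x)
  chain⇔floor n l x rewrite s-suc n | s-suc (suc n) = mk⇔
    (λ le → *≤⇒≤floor (m (suc (suc n))) (≤-trans le (≤-reflexive (sym (+-identityʳ _)))))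
    (λ le → ≤-trans (≤floor⇒*≤ (m (suc (suc n))) le) (≤-reflexive (+-identityʳ _)))

  Cone-∷ʳ⁻ : ∀ n T (v : Vec ℤ n) x → Cone (suc n) T (v ∷ʳ x) →
    + 0 ≤ x × x ≤ T × Cone n (section n x) v
  Cone-∷ʳ⁻ n T v x (inC , le) = 0≤x v inC , subst (λ A → A) (LastLe-∷ʳ v x T) le , rest v inC
    where
      0≤x : ∀ {n} (v : Vec ℤ n) → InCone s (v ∷ʳ x) → + 0 ≤ x
      0≤x []      (0≤x , _)   = 0≤x
      0≤x (a ∷ v) (0≤a , ch)  = subst (+ 0 ≤_) (last′-∷ʳ a v x) (0≤last′ 0 a (v ∷ʳ x) 0≤a ch)
      rest : ∀ {n} (v : Vec ℤ n) → InCone s (v ∷ʳ x) → Cone n (section n x) v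
      rest []      _ = tt , tt
      rest {suc n} (a ∷ v) (0≤a , ch) with ChainFrom-∷ʳ⁻ s 1 a v x ch
      ... | ch′ , le′ = (0≤a , ch′) ,
        subst (λ A → A) (sym (LastLe-∷ a v _)) (Equivalence.to (chain⇔floor n (last′ a v) x) le′)

  Cone-∷ʳ⁺ : ∀ n T (v : Vec ℤ n) x → + 0 ≤ x → x ≤ T → Cone n (section n x) v →
    Cone (suc n) T (v ∷ʳ x)
  Cone-∷ʳ⁺ n T v x 0≤x x≤T cone = inC v cone , subst (λ A → A) (sym (LastLe-∷ʳ v x T)) x≤T
    where
      inC : ∀ {n} (v : Vec ℤ n) → Cone n (section n x) v → InCone s (v ∷ʳ x)
      inC []      _ = 0≤x , tt
      inC {suc n} (a ∷ v) ((0≤a , ch) , le) = 0≤a , ChainFrom-∷ʳ⁺ s 1 a v x ch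
        (Equivalence.from (chain⇔floor n (last′ a v) x) (subst (λ A → A) (LastLe-∷ a v _) le))

  -- Built by the recursion that defines `L 0`, one fibre for each last coordinate, so that lengths
  -- match summand by summand.
  points : ∀ n → ℕ → List (Vec ℤ n)
  fibre  : ∀ n → ℕ → List (Vec ℤ (suc n))
  points zero    t = [] ∷ []
  points (suc n) t = layers (fibre n) t
  fibre n u = List.map (_∷ʳ + u) (points n (u ℕ.* m n ℕ./ m (suc n)))

  section-+ : ∀ n u → section n (+ u) ≡ + (u ℕ.* m n ℕ./ m (suc n))
  section-+ n u = cong (_/ℕ m (suc n)) (trans (+-identityʳ (+ u * + m n)) (sym (pos-* u (m n))))

  ∈-points⁻ : ∀ n t v → v ∈ points n t → Cone n (+ t) v
  ∈-points⁻ zero    t [] _ = tt , tt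
  ∈-points⁻ (suc n) t v v∈ with ∈-layers⁻ (fibre n) t v∈
  ... | u , u≤t , v∈u with ∈-map⁻ (_∷ʳ + u) v∈u
  ...   | w , w∈ , refl = Cone-∷ʳ⁺ n (+ t) w (+ u) (+≤+ ℕ.z≤n) (+≤+ u≤t)
          (subst (λ T → Cone n T w) (sym (section-+ n u)) (∈-points⁻ n _ w w∈))

  ∈-points⁺ : ∀ n t v → Cone n (+ t) v → v ∈ points n t
  ∈-points⁺ zero    t [] _ = here refl
  ∈-points⁺ (suc n) t v cone with initLast v
  ... | w , x , refl with Cone-∷ʳ⁻ n (+ t) w x cone
  ...   | +≤+ {n = u} _ , +≤+ u≤t , cone′ = ∈-layers⁺ (fibre n) (ℕₚ.≤⇒≤′ u≤t)
          (∈-map⁺ (_∷ʳ + u) (∈-points⁺ n _ w (subst (λ T → Cone n T w) (section-+ n u) cone′)))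

  points-unique : ∀ n t → Unique (points n t)
  points-unique zero    t = []ᴬ ∷ᴾ []ᴾ
  points-unique (suc n) = layers-unique (fibre n)
      (λ u → Unique.map⁺ (λ {v} {w} → ∷ʳ-injectiveˡ v w) (points-unique n _)) separate
    where
      separate : ∀ {i j v} → v ∈ fibre n i → v ∈ fibre n j → i ≡ j
      separate {i} {j} v∈i v∈j with ∈-map⁻ (_∷ʳ + i) v∈i | ∈-map⁻ (_∷ʳ + j) v∈j
      ... | w , _ , refl | w′ , _ , eq = +-injective (proj₂ (∷ʳ-injective w w′ eq))

  length-points : ∀ n t → + length (points n t) ≡ L 0 n (+ t)
  length-points zero    t = refl
  length-points (suc n) t = trans (length-layers (fibre n) t) (sumTo-cong t λ u →
    trans (cong +_ (length-map (_∷ʳ + u) (points n _)))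
      (trans (length-points n _) (cong (L 0 n) (sym (section-+ n u)))))

  points-count : ∀ n → IsEhrhartFn s n (λ t → length (points n t))
  points-count n t = points n t , points-unique n t , (λ v → ∈-points⁻ n t v , ∈-points⁺ n t v) , refl

  ehrhart≡L : ∀ n i → IsEhrhartFn s n i → ∀ z → extend (ehrhartSeries i) z ≡ L 0 n z
  ehrhart≡L n i cnt (+ t) = trans (cong +_ (IsCount-unique (cnt t) (points-count n t))) (length-points n t)
  ehrhart≡L n i cnt -[1+ k ] = sym (L-zeroBelow 0 n -[1+ k ] ℤ.-<+)

  extend-QPoly : ∀ n i → IsEhrhartFn s (suc n) i → ∀ z →
    extend (QPoly s (suc n) i) z ≡ Δ^ (suc (suc n)) (+ m (suc n)) (L 0 (suc n)) z
  extend-QPoly n i cnt z rewrite s-suc n = trans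
    (extend-^ₛ-⊛ (suc (suc n)) (+ m (suc n)) (+≤+ ℕ.z≤n) (ehrhartSeries i) z)
    (Δ^-cong (suc (suc n)) (+ m (suc n)) (ehrhart≡L (suc n) i cnt) z)

-- The weights w_n and their divisibility relations

-- The Bézout coefficients are part of the data because later divisibility arguments compute with
-- them.
record IsGCD (w x y : ℤ) : Set where
  field
    1≤w     : + 1 ≤ w
    α β     : ℤ
    combine : w ≡ α * x + β * y
    w∣x     : w ∣ x
    w∣y     : w ∣ y

-- Division with remainder: the remainder is again a combination of a and M and is less than w, so
-- minimality forbids it to be positive.
minimal-∣ : ∀ {a M w} t₀ q₀ → + 1 ≤ w → w ≡ t₀ * a - q₀ * M →
  (∀ t q → + 1 ≤ t * a - q * M → w ≤ t * a - q * M) → ∀ t q → w ∣ t * a - q * M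
minimal-∣ {w = + zero} _ _ (+≤+ ())
minimal-∣ {a} {M} {w@(+ suc k)} t₀ q₀ _ w≡ least t q = divides p (i-j≡0⇒i≡j z (p * w)
    (≤-antisym r≤0 (i≤j⇒0≤j-i ([n/ℕd]*d≤n z (suc k)))))
  where
    z = t * a - q * M
    p = z /ℕ suc k
    r<w : z - p * w < w
    r<w = <-offset _ (0≤gap (n<s[n/ℕd]*d z (suc k))) (eq z p w)
      where eq : ∀ z p w → w ≡ z - p * w + ((+ 1 + p) * w - z - + 1) + + 1
            eq = solve-∀
    r≡ : z - p * w ≡ (t - p * t₀) * a - (q - p * q₀) * M
    r≡ = trans (cong (λ u → z - p * u) w≡) (eq t a q M p t₀ q₀)
      where eq : ∀ t a q M p t₀ q₀ → t * a - q * M - p * (t₀ * a - q₀ * M) ≡ (t - p * t₀) * a - (q - p * q₀) * M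
            eq = solve-∀
    r≤0 : z - p * w ≤ + 0
    r≤0 with dichotomy (z - p * w) (+ 0)
    ... | inj₁ r≤0 = r≤0
    ... | inj₂ 0<r = ⊥-elim (<⇒≱ r<w (subst (w ≤_) (sym r≡)
            (least (t - p * t₀) (q - p * q₀) (subst (+ 1 ≤_) r≡ (<⇒1+≤ 0<r)))))

minimal⇒IsGCD : ∀ {a M w} t₀ q₀ → + 1 ≤ w → w ≡ t₀ * a - q₀ * M →
  (∀ t q → + 1 ≤ t * a - q * M → w ≤ t * a - q * M) → IsGCD w a M
minimal⇒IsGCD {a} {M} {w} t₀ q₀ 1≤w w≡ least = record
  { 1≤w = 1≤w ; α = t₀ ; β = - q₀ ; combine = trans w≡ (e₀ t₀ a q₀ M)
  ; w∣x = subst (w ∣_) (e₁ a M) (minimal-∣ t₀ q₀ 1≤w w≡ least (+ 1) (+ 0))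
  ; w∣y = subst (w ∣_) (e₂ a M) (minimal-∣ t₀ q₀ 1≤w w≡ least (+ 0) (- + 1)) }
  where
    e₀ : ∀ t a q M → t * a - q * M ≡ t * a + - q * M
    e₀ = solve-∀
    e₁ : ∀ a M → + 1 * a - + 0 * M ≡ a
    e₁ = solve-∀
    e₂ : ∀ a M → + 0 * a - - + 1 * M ≡ M
    e₂ = solve-∀

∣-^∣ : ∀ b k → ∣ (- b) ℤ.^ k ∣ ≡ ∣ b ∣ ℕ.^ k
∣-^∣ b zero    = refl
∣-^∣ b (suc k) = trans (abs-* (- b) ((- b) ℤ.^ k)) (cong₂ ℕ._*_ (∣-i∣≡∣i∣ b) (∣-^∣ b k))

∣⇒abs≤ : ∀ {i j} → j ≢ + 0 → i ∣ j → ∣ i ∣ ℕ.≤ ∣ j ∣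
∣⇒abs≤ j≢0 i∣j = ℕ∣.∣⇒≤ {{ℕ.≢-nonZero (j≢0 ∘ ∣i∣≡0⇒i≡0)}} (ℤ∣.∣⇒∣ᵤ i∣j)

*-≢0 : ∀ {i j} → i ≢ + 0 → j ≢ + 0 → i * j ≢ + 0
*-≢0 {i} i≢0 j≢0 e with i*j≡0⇒i≡0∨j≡0 i e
... | inj₁ e′ = i≢0 e′
... | inj₂ e′ = j≢0 e′

1≤⇒≢0 : ∀ {i} → + 1 ≤ i → i ≢ + 0
1≤⇒≢0 (+≤+ ()) refl

^-≢0 : ∀ {b} → b ≢ + 0 → ∀ k → b ℤ.^ k ≢ + 0
^-≢0 b≢0 (suc k) = *-≢0 b≢0 (^-≢0 b≢0 k)

-- For y = s_{k+1}, the bound that excludes y ≤ 2 |b| w with w² ∣ b^k.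
Large : ℤ → ℕ → ℤ → Set
Large b k y = + 4 * (+ ∣ b ∣ * + ∣ b ∣) * + (∣ b ∣ ℕ.^ k) < y * y

module _ {ℓ b x y z w v : ℤ} (b≢0 : b ≢ + 0) (z≡ : z ≡ ℓ * y + b * x)
  (gcd-w : IsGCD w x y) (gcd-v : IsGCD v y z) where

  private
    module W = IsGCD gcd-w
    module V = IsGCD gcd-v

  -- A common divisor of y and ℓ y + b x divides b x and b y, hence b times any combination of x and
  -- y.
  v∣bw : v ∣ b * w
  v∣bw = subst (v ∣_) (trans (cong (λ u → W.α * u + (b * W.β - W.α * ℓ) * y) z≡)
      (trans (eq W.α W.β ℓ b x y) (cong (b *_) (sym W.combine))))
    (ℤ∣.∣m∣n⇒∣m+n (ℤ∣.∣n⇒∣m*n W.α V.w∣y) (ℤ∣.∣n⇒∣m*n (b * W.β - W.α * ℓ) V.w∣x))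
    where eq : ∀ α β ℓ b x y → α * (ℓ * y + b * x) + (b * β - α * ℓ) * y ≡ b * (α * x + β * y)
          eq = solve-∀

  w∣z : w ∣ z
  w∣z = subst (w ∣_) (sym z≡) (ℤ∣.∣m∣n⇒∣m+n (ℤ∣.∣n⇒∣m*n ℓ W.w∣y) (ℤ∣.∣n⇒∣m*n b W.w∣x))

  -- A nonzero b w + v would give y ≤ ∣b w + v∣ ≤ 2 ∣b∣ w, by `v∣bw`. As w divides x, y and z, w²
  -- divides y² - x z = (-b)^k, so y² ≤ 4 b² ∣b∣^k, against `Large`.
  weight-relation-vanishes : ∀ k → y * y - x * z ≡ (- b) ℤ.^ k → Large b k y →
    y ∣ b * w + v → b * w + v ≡ + 0
  weight-relation-vanishes k cassini large y∣ with (b * w + v) ℤ.≟ + 0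
  ... | yes e = e
  ... | no ≢0 = ⊥-elim (ℕₚ.<⇒≱ largeℕ (begin
        Y ℕ.* Y                                ≤⟨ ℕₚ.*-mono-≤ Y≤ Y≤ ⟩
        (B ℕ.* W ℕ.+ B ℕ.* W) ℕ.* (B ℕ.* W ℕ.+ B ℕ.* W) ≡⟨ eq B W ⟩
        4 ℕ.* (B ℕ.* B) ℕ.* (W ℕ.* W)          ≤⟨ ℕₚ.*-monoʳ-≤ (4 ℕ.* (B ℕ.* B)) WW≤ ⟩
        4 ℕ.* (B ℕ.* B) ℕ.* (B ℕ.^ k)          ∎))
    where
      open ℕₚ.≤-Reasoning
      Y = ∣ y ∣
      B = ∣ b ∣
      W = ∣ w ∣
      -b≢0 : - b ≢ + 0
      -b≢0 = b≢0 ∘ neg-injective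
      eq : ∀ B W → (B ℕ.* W ℕ.+ B ℕ.* W) ℕ.* (B ℕ.* W ℕ.+ B ℕ.* W) ≡ 4 ℕ.* (B ℕ.* B) ℕ.* (W ℕ.* W)
      eq = ℕ-Ring.solve-∀
      ∣v∣≤ : ∣ v ∣ ℕ.≤ B ℕ.* W
      ∣v∣≤ = subst (∣ v ∣ ℕ.≤_) (abs-* b w) (∣⇒abs≤ (*-≢0 b≢0 (1≤⇒≢0 W.1≤w)) v∣bw)
      Y≤ : Y ℕ.≤ B ℕ.* W ℕ.+ B ℕ.* W
      Y≤ = begin
        Y                       ≤⟨ ∣⇒abs≤ ≢0 y∣ ⟩
        ∣ b * w + v ∣           ≤⟨ ∣i+j∣≤∣i∣+∣j∣ (b * w) v ⟩
        ∣ b * w ∣ ℕ.+ ∣ v ∣     ≡⟨ cong (ℕ._+ ∣ v ∣) (abs-* b w) ⟩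
        B ℕ.* W ℕ.+ ∣ v ∣       ≤⟨ ℕₚ.+-monoʳ-≤ (B ℕ.* W) ∣v∣≤ ⟩
        B ℕ.* W ℕ.+ B ℕ.* W     ∎
      ww∣ : w * w ∣ (- b) ℤ.^ k
      ww∣ = subst (w * w ∣_) cassini (ℤ∣.∣m∣n⇒∣m-n (both W.w∣y W.w∣y) (both W.w∣x w∣z))
        where both : ∀ {i j} → w ∣ i → w ∣ j → w * w ∣ i * j
              both {i} {j} w∣i w∣j = ℤ∣.∣-trans (ℤ∣.*-monoˡ-∣ w w∣i) (ℤ∣.*-monoʳ-∣ i w∣j)
      WW≤ : W ℕ.* W ℕ.≤ B ℕ.^ k
      WW≤ = subst₂ ℕ._≤_ (abs-* w w) (∣-^∣ b k) (∣⇒abs≤ (^-≢0 -b≢0 k) ww∣)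
      largeℕ : 4 ℕ.* (B ℕ.* B) ℕ.* (B ℕ.^ k) ℕ.< Y ℕ.* Y
      largeℕ = drop‿+<+ (subst₂ _<_ lhs (rhs y) large)
        where
          lhs : + 4 * (+ B * + B) * + (B ℕ.^ k) ≡ + (4 ℕ.* (B ℕ.* B) ℕ.* (B ℕ.^ k))
          lhs = trans (cong (λ u → + 4 * u * + (B ℕ.^ k)) (sym (pos-* B B)))
            (trans (cong (_* + (B ℕ.^ k)) (sym (pos-* 4 (B ℕ.* B)))) (sym (pos-* (4 ℕ.* (B ℕ.* B)) (B ℕ.^ k))))
          rhs : ∀ y → y * y ≡ + (∣ y ∣ ℕ.* ∣ y ∣)
          rhs (+ n)    = sym (pos-* n n)
          rhs -[1+ n ] = refl

  module _ {t u : ℤ} (t≡ : t ≡ ℓ * z + b * y) (gcd-u : IsGCD u z t)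
    (bw+v≡0 : b * w + v ≡ + 0) (bv+u≡0 : b * v + u ≡ + 0) where

    private
      module U = IsGCD gcd-u
      kx = _∣_.quotient W.w∣x
      ky = _∣_.quotient V.w∣x
      kz = _∣_.quotient U.w∣x

      solve-for : ∀ {p q} → p + q ≡ + 0 → q ≡ - p
      solve-for {p} {q} e = trans (eq p q) (trans (cong (_- p) e) (+-identityˡ (- p)))
        where eq : ∀ p q → q ≡ p + q - p
              eq = solve-∀
      v≡ : v ≡ - (b * w)
      v≡ = solve-for bw+v≡0
      u≡ : u ≡ b * b * w
      u≡ = trans (solve-for bv+u≡0) (trans (cong (λ i → - (b * i)) v≡) (eq b w))
        where eq : ∀ b w → - (b * - (b * w)) ≡ b * b * w
              eq = solve-∀
      x≡ : x ≡ kx * w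
      x≡ = _∣_.equality W.w∣x
      y≡ : y ≡ ky * - (b * w)
      y≡ = trans (_∣_.equality V.w∣x) (cong (ky *_) v≡)
      z≡′ : z ≡ kz * (b * b * w)
      z≡′ = trans (_∣_.equality U.w∣x) (cong (kz *_) u≡)
      w-nonZero : ℤ.NonZero w
      w-nonZero = ℤ.≢-nonZero (1≤⇒≢0 W.1≤w)
      bw-nonZero : ℤ.NonZero (b * w)
      bw-nonZero = ℤ.≢-nonZero (*-≢0 b≢0 (1≤⇒≢0 W.1≤w))
      -- The recurrence z = ℓ y + b x with x = kx w, y = -ky b w and z = kz b² w, divided by b w.
      kx≡ : kx ≡ kz * b + ℓ * ky
      kx≡ = *-cancelʳ-≡ kx (kz * b + ℓ * ky) (b * w) {{bw-nonZero}}
        (trans (e₁ kx b w) (trans (cong (b *_) (sym x≡)) (trans (e₂ ℓ y b x)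
          (trans (cong₂ (λ i j → i - ℓ * j) (trans (sym z≡) z≡′) y≡) (e₃ kz b w ℓ ky)))))
        where
          e₁ : ∀ kx b w → kx * (b * w) ≡ b * (kx * w)
          e₁ = solve-∀
          e₂ : ∀ ℓ y b x → b * x ≡ ℓ * y + b * x - ℓ * y
          e₂ = solve-∀
          e₃ : ∀ kz b w ℓ ky → kz * (b * b * w) - ℓ * (ky * - (b * w)) ≡ (kz * b + ℓ * ky) * (b * w)
          e₃ = solve-∀
      unit : + 1 ≡ W.α * kx - W.β * (ky * b)
      unit = *-cancelʳ-≡ (+ 1) (W.α * kx - W.β * (ky * b)) w {{w-nonZero}}
        (trans (*-identityˡ w) (trans W.combine (trans (cong₂ (λ i j → W.α * i + W.β * j) x≡ y≡)
          (eq W.α W.β kx ky b w))))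
        where eq : ∀ α β kx ky b w → α * (kx * w) + β * (ky * - (b * w)) ≡ (α * kx - β * (ky * b)) * w
              eq = solve-∀

    ∣middle : b ∣ y
    ∣middle = divides (- (ky * w)) (trans y≡ (eq ky b w))
      where eq : ∀ ky b w → ky * - (b * w) ≡ - (ky * w) * b
            eq = solve-∀

    -- Bézout for x and y, divided by w, reads 1 = α kx - β ky b. Modulo b, kx is ℓ ky, so α ky
    -- inverts ℓ.
    ℓ-unit : Σ ℤ λ i → b ∣ + 1 - i * ℓ
    ℓ-unit = W.α * ky , divides (W.α * kz - W.β * ky)
      (trans (cong (_- W.α * ky * ℓ) (trans unit (cong (λ j → W.α * j - W.β * (ky * b)) kx≡)))
        (eq W.α W.β kz ky b ℓ))
      where eq : ∀ α β kz ky b ℓ → α * (kz * b + ℓ * ky) - β * (ky * b) - α * ky * ℓ ≡ (α * kz - β * ky) * b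
            eq = solve-∀

-- Growth of the sequence

square-mono-≤ : ∀ {x y} → + 0 ≤ x → x ≤ y → x * x ≤ y * y
square-mono-≤ {x} {y} 0≤x x≤y = ≤-offset ((y - x) * (y - x) + + 2 * (x * (y - x)))
    (0≤-+ (0≤-* 0≤y-x 0≤y-x) (0≤-* {+ 2} (+≤+ ℕ.z≤n) (0≤-* 0≤x 0≤y-x))) (eq x y)
  where
    0≤y-x = i≤j⇒0≤j-i x≤y
    eq : ∀ x y → y * y ≡ x * x + ((y - x) * (y - x) + + 2 * (x * (y - x)))
    eq = solve-∀

square-mono-< : ∀ {x y} → + 0 ≤ x → x < y → x * x < y * y
square-mono-< {x} {y} 0≤x x<y = <-offset (d * d + + 2 * (x * d) + + 2 * d + + 2 * x)
    (0≤-+ (0≤-+ (0≤-+ (0≤-* 0≤d 0≤d) (0≤-* {+ 2} (+≤+ ℕ.z≤n) (0≤-* 0≤x 0≤d))) (0≤-* {+ 2} (+≤+ ℕ.z≤n) 0≤d))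
      (0≤-* {+ 2} (+≤+ ℕ.z≤n) 0≤x)) (eq x y)
  where
    d = y - x - + 1
    0≤d = 0≤gap x<y
    eq : ∀ x y → y * y ≡ x * x + ((y - x - + 1) * (y - x - + 1) + + 2 * (x * (y - x - + 1)) + + 2 * (y - x - + 1) + + 2 * x) + + 1
    eq = solve-∀

Increasing : (ℕ → ℤ) → Set
Increasing s = ∀ n → + 1 ≤ s (suc n) × s (suc n) ≤ s (suc (suc n))

module Recurrence (ℓ b : ℤ) where

  S : ℕ → ℤ
  S = seq ℓ b

  cassini : ∀ k → S (suc k) * S (suc k) - S k * S (suc (suc k)) ≡ (- b) ℤ.^ k
  cassini zero    = refl
  cassini (suc k) = trans (eq ℓ b (S k) (S (suc k))) (cong (λ w → - b * w) (cassini k))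
    where eq : ∀ ℓ b x y → (ℓ * y + b * x) * (ℓ * y + b * x) - y * (ℓ * (ℓ * y + b * x) + b * y)
                 ≡ - b * (y * y - x * (ℓ * y + b * x))
          eq = solve-∀

  -- If b divides s_{j+2} = ℓ s_{j+1} + b s_j, it divides ℓ s_{j+1}, and ℓ can be cancelled modulo
  -- b. The descent ends at s_1 = 1.
  descend-∣ : ∀ i → b ∣ + 1 - i * ℓ → ∀ j → b ∣ S (suc j) → b ∣ + 1
  descend-∣ i unit zero    b∣ = b∣
  descend-∣ i unit (suc j) b∣ = descend-∣ i unit j
    (subst (b ∣_) (eq i ℓ (S (suc j)))
      (ℤ∣.∣m∣n⇒∣m+n (ℤ∣.∣m⇒∣m*n (S (suc j)) unit)
        (ℤ∣.∣n⇒∣m*n i (ℤ∣.∣m+n∣n⇒∣m {m = ℓ * S (suc j)} b∣ (ℤ∣.∣m⇒∣m*n (S j) ℤ∣.∣-refl)))))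
    where eq : ∀ i ℓ y → (+ 1 - i * ℓ) * y + i * (ℓ * y) ≡ y
          eq = solve-∀

module Positive (ℓ : ℤ) (β : ℕ) (1≤ℓ : + 1 ≤ ℓ) where

  private
    b : ℤ
    b = + suc β
  open Recurrence ℓ b

  signs : ∀ n → + 0 ≤ S n × + 1 ≤ S (suc n)
  grow : ∀ n → S (suc n) ≤ S (suc (suc n))
  grow n = ≤-offset ((ℓ - + 1) * S (suc n) + b * S n)
      (0≤-+ (0≤-* (i≤j⇒0≤j-i 1≤ℓ) (≤-trans (+≤+ ℕ.z≤n) (proj₂ (signs n)))) (0≤-* {b} (+≤+ ℕ.z≤n) (proj₁ (signs n))))
      (eq ℓ b (S n) (S (suc n)))
    where eq : ∀ ℓ b x y → ℓ * y + b * x ≡ y + ((ℓ - + 1) * y + b * x)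
          eq = solve-∀
  signs zero    = ≤-refl , ≤-refl
  signs (suc n) = ≤-trans (+≤+ ℕ.z≤n) (proj₂ (signs n)) , ≤-trans (proj₂ (signs n)) (grow n)

  increasing : Increasing S
  increasing n = proj₂ (signs n) , grow n

  1≤S : ∀ n → + 1 ≤ S (suc n)
  1≤S n = proj₂ (signs n)

  -- Two steps of the recurrence multiply by at least b + 1, since ℓ z + b y ≥ z + b y ≥ (1 + b) y.
  -- Over the same two steps the square root of b^n grows only by the factor b.
  odd-growth : ∀ k → + (suc (suc β) ℕ.^ k) ≤ S (suc (k ℕ.+ k))
  odd-growth zero    = ≤-refl
  odd-growth (suc k) rewrite ℕₚ.+-suc k k = ≤-trans
      (≤-trans (≤-reflexive (pos-* (suc (suc β)) (suc (suc β) ℕ.^ k)))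
        (*-monoˡ-≤-nonNeg (+ suc (suc β)) (odd-growth k)))
      (≤-offset ((ℓ - + 1) * z + (z - y)) (0≤-+ (0≤-* (i≤j⇒0≤j-i 1≤ℓ) (≤-trans (+≤+ ℕ.z≤n) (1≤S (suc j)))) (i≤j⇒0≤j-i (grow j)))
        (eq ℓ b y z))
    where
      j = k ℕ.+ k
      y = S (suc j)
      z = S (suc (suc j))
      eq : ∀ ℓ b y z → ℓ * z + b * y ≡ (+ 1 + b) * y + ((ℓ - + 1) * z + (z - y))
      eq = solve-∀

  -- Bernoulli's inequality (1 + 1/c)^k ≥ 1 + k/c, cleared of denominators.
  bernoulli : ∀ c k → (c ℕ.+ k) ℕ.* c ℕ.^ k ℕ.≤ c ℕ.* suc c ℕ.^ k
  bernoulli c zero    = ℕₚ.≤-reflexive (cong (ℕ._* 1) (ℕₚ.+-identityʳ c))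
  bernoulli c (suc k) = begin
      (c ℕ.+ suc k) ℕ.* (c ℕ.* C)                          ≤⟨ ℕₚ.m≤m+n _ (k ℕ.* C) ⟩
      (c ℕ.+ suc k) ℕ.* (c ℕ.* C) ℕ.+ k ℕ.* C              ≡⟨ eq₁ c k C ⟩
      suc c ℕ.* ((c ℕ.+ k) ℕ.* C)                          ≤⟨ ℕₚ.*-monoʳ-≤ (suc c) (bernoulli c k) ⟩
      suc c ℕ.* (c ℕ.* suc c ℕ.^ k)                        ≡⟨ eq₂ c (suc c ℕ.^ k) ⟩
      c ℕ.* (suc c ℕ.* suc c ℕ.^ k)                        ∎
    where
      open ℕₚ.≤-Reasoning
      C = c ℕ.^ k
      eq₁ : ∀ c k C → (c ℕ.+ suc k) ℕ.* (c ℕ.* C) ℕ.+ k ℕ.* C ≡ suc c ℕ.* ((c ℕ.+ k) ℕ.* C)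
      eq₁ = ℕ-Ring.solve-∀
      eq₂ : ∀ c D → suc c ℕ.* (c ℕ.* D) ≡ c ℕ.* (suc c ℕ.* D)
      eq₂ = ℕ-Ring.solve-∀

  private
    c = suc β
    -- With this h, c (c+1)^h ≥ (c + h) c^h > h c^h = c · 2c · c^h, so (c+1)^h exceeds 2c · c^h,
    -- whose square is the bound in `Large` for exponent 2h.
    h = 2 ℕ.* (c ℕ.* c)
    F = c ℕ.^ h

  1≤F : 1 ℕ.≤ F
  1≤F = ℕₚ.m^n>0 c h

  odd-large : Large b (h ℕ.+ h) (S (suc (h ℕ.+ h)))
  odd-large = subst (_< Y * Y) square (square-mono-< (+≤+ ℕ.z≤n) (<-≤-trans (ℤ.+<+ lower) (odd-growth h)))
    where
      Y = S (suc (h ℕ.+ h))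
      square : + (2 ℕ.* c ℕ.* F) * + (2 ℕ.* c ℕ.* F) ≡ + 4 * (+ c * + c) * + (c ℕ.^ (h ℕ.+ h))
      square = trans (cong₂ _*_ e e) (trans (eq (+ c) (+ F))
        (cong (λ w → + 4 * (+ c * + c) * w) (trans (sym (pos-* F F)) (cong +_ (sym (ℕₚ.^-distribˡ-+-* c h h))))))
        where
          e : + (2 ℕ.* c ℕ.* F) ≡ + 2 * + c * + F
          e = trans (pos-* (2 ℕ.* c) F) (cong (_* + F) (pos-* 2 c))
          eq : ∀ c F → + 2 * c * F * (+ 2 * c * F) ≡ + 4 * (c * c) * (F * F)
          eq = solve-∀
      lower : 2 ℕ.* c ℕ.* F ℕ.< suc c ℕ.^ h
      lower = ℕₚ.*-cancelˡ-< c (2 ℕ.* c ℕ.* F) (suc c ℕ.^ h) (begin-strict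
          c ℕ.* (2 ℕ.* c ℕ.* F)     ≡⟨ eq c F ⟩
          h ℕ.* F                   <⟨ ℕₚ.m<n+m (h ℕ.* F) (ℕₚ.*-mono-≤ {1} {c} (ℕ.s≤s ℕ.z≤n) 1≤F) ⟩
          c ℕ.* F ℕ.+ h ℕ.* F       ≡⟨ sym (ℕₚ.*-distribʳ-+ F c h) ⟩
          (c ℕ.+ h) ℕ.* F           ≤⟨ bernoulli c h ⟩
          c ℕ.* suc c ℕ.^ h         ∎)
        where
          open ℕₚ.≤-Reasoning
          eq : ∀ c F → c ℕ.* (2 ℕ.* c ℕ.* F) ≡ 2 ℕ.* (c ℕ.* c) ℕ.* F
          eq = ℕ-Ring.solve-∀

module Negative (ℓ : ℤ) (β : ℕ) (1≤ℓ : + 1 ≤ ℓ) (disc : + 0 ≤ ℓ * ℓ + + 4 * -[1+ β ]) where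

  private
    b B : ℤ
    b = -[1+ β ]
    B = + suc β
  open Recurrence ℓ b

  0≤ℓ : + 0 ≤ ℓ
  0≤ℓ = ≤-trans (+≤+ ℕ.z≤n) 1≤ℓ

  2≤ℓ : + 2 ≤ ℓ
  2≤ℓ with dichotomy ℓ (+ 1)
  ... | inj₂ 1<ℓ = <⇒1+≤ 1<ℓ
  ... | inj₁ ℓ≤1 = ⊥-elim (<⇒≱ (<-offset (+ 4 * + β + + 2) (0≤-+ (0≤-* {+ 4} {+ β} (+≤+ ℕ.z≤n) (+≤+ ℕ.z≤n)) (+≤+ {n = 2} ℕ.z≤n))
          (eq (+ β))) (subst (λ l → + 0 ≤ l * l + + 4 * b) (≤-antisym ℓ≤1 1≤ℓ) disc))
    where eq : ∀ β → + 0 ≡ + 1 * + 1 + + 4 * - (+ 1 + β) + (+ 4 * β + + 2) + + 1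
          eq = solve-∀

  halve : ∀ {x y} → + 2 * x ≤ + 2 * y → x ≤ y
  halve {x} {y} = *-cancelˡ-≤-pos x y (+ 2)

  -- The bound is inductive because 4 s_{n+2} = 2ℓ s_{n+1} + ℓ (2 s_{n+1} - ℓ s_n) + (ℓ² + 4b) s_n,
  -- where the last two terms are nonnegative. With ℓ ≥ 2 it gives positivity and monotonicity.
  ratio : ∀ n → + 0 ≤ S n × + 1 ≤ S (suc n) × ℓ * S n ≤ + 2 * S (suc n)
  from-ratio : ∀ n → ℓ * S (suc n) ≤ + 2 * S (suc (suc n)) → + 0 ≤ S (suc n) → S (suc n) ≤ S (suc (suc n))
  from-ratio n r 0≤y = halve (≤-trans (*-monoʳ-≤-nonNeg (S (suc n)) {{ℤ.nonNegative 0≤y}} 2≤ℓ) r)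
  ratio zero    = ≤-refl , ≤-refl , ≤-trans (≤-reflexive (*-zeroʳ ℓ)) (+≤+ ℕ.z≤n)
  ratio (suc n) with ratio n
  ... | 0≤x , 1≤y , r = 0≤y , ≤-trans 1≤y (from-ratio n r′ 0≤y) , r′
    where
      x = S n
      y = S (suc n)
      0≤y : + 0 ≤ y
      0≤y = ≤-trans (+≤+ ℕ.z≤n) 1≤y
      eq : ∀ ℓ b x y → + 2 * (+ 2 * (ℓ * y + b * x)) ≡ + 2 * (ℓ * y) + (ℓ * (+ 2 * y - ℓ * x) + (ℓ * ℓ + + 4 * b) * x)
      eq = solve-∀
      r′ : ℓ * y ≤ + 2 * S (suc (suc n))
      r′ = halve (≤-offset _ (0≤-+ (0≤-* 0≤ℓ (i≤j⇒0≤j-i r)) (0≤-* disc 0≤x)) (eq ℓ b x y))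

  increasing : Increasing S
  increasing n with ratio (suc n)
  ... | 0≤y , _ , r = proj₁ (proj₂ (ratio n)) , from-ratio n r 0≤y

  0≤S : ∀ n → + 0 ≤ S n
  0≤S n = proj₁ (ratio n)

  -- Equality holds for a double root, where s_k = k (ℓ/2)^{k-1}.
  sharp-ratio : ∀ k → + suc k * ℓ * S k ≤ + 2 * + k * S (suc k)
  sharp-ratio zero    = ≤-reflexive (*-zeroʳ (+ 1 * ℓ))
  sharp-ratio (suc k) = halve (≤-offset _
      (0≤-+ (0≤-* 0≤ℓ (i≤j⇒0≤j-i (sharp-ratio k))) (0≤-* {+ suc k} (+≤+ ℕ.z≤n) (0≤-* disc (0≤S k))))
      (eq ℓ b (S k) (S (suc k)) (+ k)))
    where eq : ∀ ℓ b x y k → + 2 * (+ 2 * (+ 1 + k) * (ℓ * y + b * x))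
                 ≡ + 2 * ((+ 1 + (+ 1 + k)) * ℓ * y) + (ℓ * (+ 2 * k * y - (+ 1 + k) * ℓ * x) + (+ 1 + k) * ((ℓ * ℓ + + 4 * b) * x))
          eq = solve-∀

  -- Square `sharp-ratio` and use ℓ² ≥ 4 ∣b∣. The quadratic factor makes s_n² / ∣b∣^{n-1} unbounded
  -- even when the discriminant is 0.
  square-growth : ∀ k → + suc k * + suc k * + (suc β ℕ.^ k) ≤ S (suc k) * S (suc k)
  square-growth zero    = ≤-refl
  square-growth (suc k) = *-cancelˡ-≤-pos _ _ (+ 4 * (K * K)) (≤-trans
      (≤-offset ((L * L) * ((ℓ * ℓ + + 4 * b) * (y * y) + + 4 * B * (y * y - K * K * E)))
        (0≤-* {L * L} (+≤+ ℕ.z≤n) (0≤-+ (0≤-* disc (0≤-* (0≤S (suc k)) (0≤S (suc k)))) (0≤-* {+ 4 * B} (+≤+ ℕ.z≤n) (i≤j⇒0≤j-i (square-growth k)))))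
        (trans (eq ℓ B y K L E) (cong (λ p → + 4 * (K * K) * (L * L * p) + L * L * ((ℓ * ℓ + + 4 * b) * (y * y) + + 4 * B * (y * y - K * K * E)))
          (sym (pos-* (suc β) (suc β ℕ.^ k))))))
      (≤-trans (square-mono-≤ (0≤-* (0≤-* {L} (+≤+ ℕ.z≤n) 0≤ℓ) (0≤S (suc k))) (sharp-ratio (suc k)))
        (≤-reflexive (eq′ K z))))
    where
      K = + suc k
      L = + suc (suc k)
      y = S (suc k)
      z = S (suc (suc k))
      E = + (suc β ℕ.^ k)
      eq : ∀ ℓ B y K L E → L * ℓ * y * (L * ℓ * y)
           ≡ + 4 * (K * K) * (L * L * (B * E)) + L * L * ((ℓ * ℓ + + 4 * - B) * (y * y) + + 4 * B * (y * y - K * K * E))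
      eq = solve-∀
      eq′ : ∀ K z → + 2 * K * z * (+ 2 * K * z) ≡ + 4 * (K * K) * (z * z)
      eq′ = solve-∀

  large : ∀ k → 2 ℕ.* suc β ℕ.≤ k → Large b k (S (suc k))
  large k 2B≤k = <-≤-trans (<-offset (E * (+ 4 * B + (r * r + + 2 * r + + 4 * B * r)) + (E - + 1))
      (0≤-+ (0≤-* {E} (+≤+ ℕ.z≤n) (0≤-+ {+ 4 * B} (+≤+ ℕ.z≤n) (0≤-+ (0≤-+ (0≤-* 0≤r 0≤r) (0≤-* {+ 2} (+≤+ ℕ.z≤n) 0≤r)) (0≤-* {+ 4 * B} (+≤+ ℕ.z≤n) 0≤r))))
        (i≤j⇒0≤j-i (+≤+ (ℕₚ.m^n>0 (suc β) k))))
      (eq (+ k) B E)) (square-growth k)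
    where
      E = + (suc β ℕ.^ k)
      -- For r ≥ 0 one has (k + 1)² ≥ (2B + 1)² > 4B², which is what `Large` asks of the quadratic
      -- factor.
      r = + k - + 2 * B
      0≤r : + 0 ≤ r
      0≤r = i≤j⇒0≤j-i (≤-trans (≤-reflexive (sym (pos-* 2 (suc β)))) (+≤+ 2B≤k))
      eq : ∀ k B E → (+ 1 + k) * (+ 1 + k) * E ≡ + 4 * (B * B) * E
           + (E * (+ 4 * B + ((k - + 2 * B) * (k - + 2 * B) + + 2 * (k - + 2 * B) + + 4 * B * (k - + 2 * B))) + (E - + 1)) + + 1
      eq = solve-∀

-- Symmetry of the h*-vector

module Symmetry (ℓ b : ℤ) (b≢0 : b ≢ + 0) (inc : Increasing (seq ℓ b)) where
  open Recurrence ℓ b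

  -- At 0 the value makes `m 0` equal to 1 although s_0 = 0; the base case of `gorenstein-suc`
  -- relies on it.
  μ : ℕ → ℕ
  μ zero    = 0
  μ (suc n) = ℕ.pred ∣ S (suc n) ∣

  S-suc : ∀ n → S (suc n) ≡ + suc (μ (suc n))
  S-suc n = pos (proj₁ (inc n))
    where pos : ∀ {x} → + 1 ≤ x → x ≡ + suc (ℕ.pred ∣ x ∣)
          pos {+ suc k} _ = refl
          pos {+ zero} (+≤+ ())

  open Lattice μ
  open Counting μ S S-suc

  m≤m : ∀ n → + m (suc n) ≤ + m (suc (suc n))
  m≤m n = subst₂ _≤_ (S-suc n) (S-suc (suc n)) (proj₂ (inc n))

  symmetric⇒Gor : ∀ n → HStarSymmetric S (suc n) → Σ ℤ (Gorenstein (suc n))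
  symmetric⇒Gor n symm = symmetric⇒Gorenstein (suc n) _ (extend-QPoly n _ cnt) (symm _ cnt)
    where cnt = points-count (suc n)

  Gor⇒symmetric : ∀ n {c} → Gorenstein (suc n) c → HStarSymmetric S (suc n)
  Gor⇒symmetric n gor i cnt = Gorenstein⇒symmetric (suc n) (QPoly S (suc n) i) (extend-QPoly n i cnt) gor

  -- Read contrapositively, failure of the Gorenstein property in one dimension persists in all
  -- larger ones. Hence refuting a single dimension yields the asymptotic claim.
  descend : ∀ {N n} → suc n ℕ.≤′ N → Σ ℤ (Gorenstein N) → Σ ℤ (Gorenstein (suc n))
  descend (ℕ.≤′-reflexive refl) g = g
  descend {suc zero} (ℕ.≤′-step (ℕ.≤′-reflexive ()))
  descend {suc (suc N)} (ℕ.≤′-step le) (c , gor) = descend le (shiftDown N gor (m≤m N) , Gorenstein-pred N gor (m≤m N))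

  weight : ℕ → ℤ → ℤ → ℤ
  weight n c c′ = c * S (suc n) - c′ * S (suc (suc n))

  record Link (n : ℕ) (c : ℤ) : Set where
    field
      c′     : ℤ
      gor    : Gorenstein (suc n) c′
      isGCD  : IsGCD (weight n c c′) (S (suc n)) (S (suc (suc n)))

  link : ∀ n {c} → Gorenstein (suc (suc n)) c → Link n c
  link n {c} gor = record
    { c′ = c′
    ; gor = Gorenstein-pred n gor (m≤m n)
    ; isGCD = subst₂ (λ a M → IsGCD (c * a - c′ * M) a M) (sym (S-suc n)) (sym (S-suc (suc n)))
        (minimal⇒IsGCD c c′ (1≤weight n gor (m≤m n)) refl (weight-minimal n gor (m≤m n))) }
    where c′ = shiftDown n gor (m≤m n)

  -- Inserting the recurrence for s_{n+3} cancels the terms b c′ s_{n+1}; every remaining term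
  -- contains s_{n+2}.
  ∣relation : ∀ n c c′ c″ → S (suc (suc n)) ∣ b * weight n c′ c″ + weight (suc n) c c′
  ∣relation n c c′ c″ = divides (c - ℓ * c′ - b * c″) (eq ℓ b (S (suc n)) (S (suc (suc n))) c c′ c″)
    where eq : ∀ ℓ b x y c c′ c″ → b * (c′ * x - c″ * y) + (c * y - c′ * (ℓ * y + b * x)) ≡ (c - ℓ * c′ - b * c″) * y
          eq = solve-∀

  relation-vanishes : ∀ n c c′ c″ → IsGCD (weight n c′ c″) (S (suc n)) (S (suc (suc n))) →
    IsGCD (weight (suc n) c c′) (S (suc (suc n))) (S (suc (suc (suc n)))) →
    Large b (suc n) (S (suc (suc n))) → b * weight n c′ c″ + weight (suc n) c c′ ≡ + 0
  relation-vanishes n c c′ c″ g g′ large =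
    weight-relation-vanishes {ℓ = ℓ} b≢0 refl g g′ (suc n) (cassini (suc n)) large (∣relation n c c′ c″)

  -- With b ≥ 1 and both weights at least 1, the vanishing sum would be positive.
  refute-pos : ∀ n → + 1 ≤ b → Large b (suc n) (S (suc (suc n))) → ¬ Σ ℤ (Gorenstein (suc (suc (suc n))))
  refute-pos n 1≤b large (c , gor) with link (suc n) gor
  ... | record { c′ = c′ ; gor = gor′ ; isGCD = g′ } with link n gor′
  ...   | record { c′ = c″ ; isGCD = g } =
    1≤⇒≢0 (≤-trans (IsGCD.1≤w g′) (≤-offset (b * weight n c′ c″)
        (0≤-* (≤-trans (+≤+ ℕ.z≤n) 1≤b) (≤-trans (+≤+ ℕ.z≤n) (IsGCD.1≤w g)))
        (+-comm (b * weight n c′ c″) (weight (suc n) c c′))))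
      (relation-vanishes n c c′ c″ g g′ large)

  -- Two consecutive vanishing relations make ℓ invertible modulo b and b a divisor of s_{n+2};
  -- `descend-∣` then reaches s_1.
  refute-neg : ∀ n → Large b (suc n) (S (suc (suc n))) → Large b (suc (suc n)) (S (suc (suc (suc n)))) →
    Σ ℤ (Gorenstein (suc (suc (suc (suc n))))) → b ∣ + 1
  refute-neg n large large′ (c , gor) with link (suc (suc n)) gor
  ... | record { c′ = c′ ; gor = gor′ ; isGCD = g″ } with link (suc n) gor′
  ...   | record { c′ = c″ ; gor = gor″ ; isGCD = g′ } with link n gor″
  ...     | record { c′ = c‴ ; isGCD = g } = descend-∣ (proj₁ unit) (proj₂ unit) (suc n)
              (∣middle {ℓ = ℓ} b≢0 refl g g′ refl g″ e e′)
    where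
      e = relation-vanishes n c′ c″ c‴ g g′ large
      e′ = relation-vanishes (suc n) c c′ c″ g′ g″ large′
      unit = ℓ-unit {ℓ = ℓ} b≢0 refl g g′ refl g″ e e′

module Minus-one (ℓ : ℤ) (inc : Increasing (seq ℓ -[1+ 0 ])) where
  open Recurrence ℓ -[1+ 0 ]
  open Symmetry ℓ -[1+ 0 ] (λ ()) inc
  open Lattice μ

  -- For b = -1 Cassini's identity y² - x z = 1 rearranges to (z + y) y = (y + x) z + 1, the
  -- hypothesis of `Gorenstein-suc`.
  gorenstein-suc : ∀ n → Gorenstein (suc n) (S (suc n) + S n)
  gorenstein-suc zero    = Gorenstein-suc 0 {+ 1} {+ 0} refl Gorenstein-zero
  gorenstein-suc (suc n) = Gorenstein-suc (suc n)
    (subst₂ (λ a M → (S (suc (suc n)) + S (suc n)) * a ≡ (S (suc n) + S n) * M + + 1) (S-suc n) (S-suc (suc n))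
      (trans (eq (S n) (S (suc n)) (S (suc (suc n))))
        (cong (λ w → (S (suc n) + S n) * S (suc (suc n)) + w) (trans (cassini n) (^-zeroˡ n)))))
    (gorenstein-suc n)
    where eq : ∀ x y z → (z + y) * y ≡ (y + x) * z + (y * y - x * z)
          eq = solve-∀

not-symmetric : ∀ ℓ b → + 1 ≤ ℓ → b ≢ + 0 → + 0 ≤ ℓ * ℓ + + 4 * b → b ≢ -[1+ 0 ] →
  Σ ℕ λ n₀ → ∀ n → n₀ ℕ.≤ n → ¬ HStarSymmetric (seq ℓ b) n
not-symmetric ℓ (+ zero) _ b≢0 _ _ = ⊥-elim (b≢0 refl)
not-symmetric ℓ b@(+ suc β) 1≤ℓ b≢0 _ _ = suc (suc (suc n₀)) , refute
  where
    open Positive ℓ β 1≤ℓ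
    open Symmetry ℓ b b≢0 increasing
    h = 2 ℕ.* (suc β ℕ.* suc β)
    -- Thus `suc n₀` is `h + h`, the exponent in `odd-large`; the threshold n₀ + 3 is the dimension
    -- that `refute-pos` excludes.
    n₀ = ℕ.pred (h ℕ.+ h)
    refute : ∀ n → suc (suc (suc n₀)) ℕ.≤ n → ¬ HStarSymmetric (seq ℓ b) n
    refute (suc n) n₀≤n symm = refute-pos n₀ (+≤+ (ℕ.s≤s ℕ.z≤n)) odd-large
      (descend (ℕₚ.≤⇒≤′ n₀≤n) (symmetric⇒Gor n symm))
not-symmetric ℓ b@(-[1+ β ]) 1≤ℓ b≢0 disc b≢-1 = suc (suc (suc (suc n₀))) , refute
  where
    open Negative ℓ β 1≤ℓ disc
    open Symmetry ℓ b b≢0 increasing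
    -- The bound from which `large` applies; `refute-neg` concerns dimension n₀ + 4.
    n₀ = 2 ℕ.* suc β
    refute : ∀ n → suc (suc (suc (suc n₀))) ℕ.≤ n → ¬ HStarSymmetric (seq ℓ b) n
    -- A negative b dividing 1 has `suc β` = 1, hence is -1.
    refute (suc n) n₀≤n symm = b≢-1 (cong -[1+_] (ℕₚ.suc-injective (ℕ∣.∣1⇒≡1 (ℤ∣.∣⇒∣ᵤ
      (refute-neg n₀ (large (suc n₀) (ℕₚ.n≤1+n n₀)) (large (suc (suc n₀)) (ℕₚ.m≤n⇒m≤1+n (ℕₚ.n≤1+n n₀)))
        (descend (ℕₚ.≤⇒≤′ n₀≤n) (symmetric⇒Gor n symm)))))))

theorem4p4 : (ℓ b : ℤ) → + 0 ℤ.< ℓ → b ≢ + 0 → + 0 ℤ.≤ ℓ * ℓ + + 4 * b →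
    (((n : ℕ) → 1 ℕ.≤ n → HStarSymmetric (seq ℓ b) n) ⇔ (b ≡ -[1+ 0 ]))
    × (b ≢ -[1+ 0 ] →
    Σ ℕ (λ n₀ → (n : ℕ) → n₀ ℕ.≤ n → ¬ HStarSymmetric (seq ℓ b) n))
theorem4p4 ℓ b 0<ℓ b≢0 disc = mk⇔ forced symmetric , asymptotic
  where
    1≤ℓ = <⇒1+≤ 0<ℓ
    asymptotic = not-symmetric ℓ b 1≤ℓ b≢0 disc
    forced : ((n : ℕ) → 1 ℕ.≤ n → HStarSymmetric (seq ℓ b) n) → b ≡ -[1+ 0 ]
    forced symm with b ℤ.≟ -[1+ 0 ]
    ... | yes b≡-1 = b≡-1
    ... | no b≢-1 with asymptotic b≢-1
    ...   | n₀ , refute = ⊥-elim (refute (suc n₀) (ℕₚ.n≤1+n n₀) (symm (suc n₀) (ℕ.s≤s ℕ.z≤n)))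
    symmetric : b ≡ -[1+ 0 ] → (n : ℕ) → 1 ℕ.≤ n → HStarSymmetric (seq ℓ b) n
    symmetric refl (suc n) _ = Symmetry.Gor⇒symmetric ℓ b b≢0 inc n (Minus-one.gorenstein-suc ℓ inc n)
      where inc = Negative.increasing ℓ 0 1≤ℓ disc
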